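{- Let $C_n$ be the cycle on $n\geq 4$ vertices. Then \[\frac{n}{8}\left(1-O\left(\frac{\log n}{n}\right)\right)\leq \mathrm{dct}(C_n)\leq \frac{n+1}{8}.\] In particular $\mathrm{dct}(C_n)=(1+o(1))n/8$ and the cost of drunkenness satisfies $F(C_n)=\mathrm{ct}(C_n)/\mathrm{dct}(C_n)=2+o(1)$, where asymptotics are as $n\to\infty$.
   Context: Cops and robber game on a finite connected graph $G=(V,E)$ with $k$ cops: in round $0$ the cops choose positions $x\in V^k$, then the robber chooses his initial vertex; in each round $t\ge1$ first each cop moves along an edge or stays, then the robber moves. Capture time $T$ is the first time a cop and the robber occupy the same vertex. The cop number $c(G)$ is the minimum $k$ for which the cops can guarantee capture of a robber who sees everything and plays optimally. $\mathrm{ct}_{x,y}(G,k)$ is the capture time from $(x,y)$ under optimal play (cops minimizing, robber maximizing); $\mathrm{ct}(G,k)=\min_{x}\max_{y}\mathrm{ct}_{x,y}(G,k)$ and $\mathrm{ct}(G)=\mathrm{ct}(G,c(G))$. In the drunk robber version, after the cops choose $x$ the robber's initial vertex is uniformly random in $V$, and in each round the robber moves to a uniformly random neighbour of his current vertex (open neighbourhood; he never stays), independently of the cops; the cops see him. $\mathrm{dct}_{x,y}(G,k)$ is the expected capture time from $(x,y)$ when the cops play to minimize it, $\mathrm{dct}(G,k)=\min_{x\in V^k}\frac{1}{|V|}\sum_{y\in V}\mathrm{dct}_{x,y}(G,k)$, $\mathrm{dct}(G)=\mathrm{dct}(G,c(G))$, and $F(G)=\mathrm{ct}(G)/\mathrm{dct}(G)$.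 For the cycle, $c(C_n)=2$. -}

module Defs where

open import Data.Bool using (Bool; true; false; not; _∨_)
open import Data.Nat using (ℕ; zero; suc; _+_; _∸_; NonZero)
open import Data.Nat.DivMod using (_mod_)
open import Data.Fin using (Fin; toℕ; _≟_)
open import Data.Fin.Base using () renaming (zero to fzero; suc to fsuc)
open import Data.Vec using (Vec; lookup)
open import Data.List using (List; []; _∷_; map; filterᵇ; concatMap; length; allFin)
open import Data.Integer using (+_)
open import Data.Rational using (ℚ; _/_; 0ℚ; 1ℚ; ½) renaming (_+_ to _+ℚ_; _*_ to _*ℚ_)
open import Relation.Nullary.Decidable using (⌊_⌋)
open import Relation.Binary.PropositionalEquality using (_≡_)
open import Data.Sum using (_⊎_)

module Cycle (n : ℕ) .{{_ : NonZero n}} where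

  right : Fin n → Fin n
  right i = (suc (toℕ i)) mod n

  left : Fin n → Fin n
  left i = (toℕ i + (n ∸ 1)) mod n

  -- the two robber moves (open neighbourhood; for n ≥ 3 these are distinct)
  neighbours : Fin n → List (Fin n)
  neighbours i = right i ∷ left i ∷ []

  -- positions of the 2 cops (c(C_n) = 2)
  Cops : Set
  Cops = Vec (Fin n) 2

  CopStep : Fin n → Fin n → Set
  CopStep a b = (b ≡ a) ⊎ (b ≡ right a) ⊎ (b ≡ left a)

  hit : Fin n → Cops → Bool
  hit v c = ⌊ lookup c fzero ≟ v ⌋ ∨ ⌊ lookup c (fsuc fzero) ≟ v ⌋

  -- A deterministic, history-dependent cop strategy (cops see everything).
  -- pos [] is the initial placement x; pos (r_{t-1} ∷ … ∷ r_0 ∷ []) is the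
  -- cops' position in round t, after seeing the robber's history r_0 … r_{t-1}.
  record Strategy : Set where
    field
      pos   : List (Fin n) → Cops
      valid : ∀ (h : List (Fin n)) (r : Fin n) (i : Fin 2) →
              CopStep (lookup (pos h) i) (lookup (pos (r ∷ h)) i)
  open Strategy public

  -- survivors σ t : the (reversed) robber walks r_t ∷ … ∷ r_0 (over all starting
  -- vertices and all neighbour choices, with multiplicity) that have not been
  -- captured by the end of round t, i.e. T > t.
  survivors : Strategy → ℕ → List (List (Fin n))
  survivors σ zero =
    map (λ y → y ∷ []) (filterᵇ (λ y → not (hit y (pos σ []))) (allFin n))
  survivors σ (suc t) = concatMap step (survivors σ t)
    where
    step : List (Fin n) → List (List (Fin n))
    step [] = []
    step (r ∷ h) with hit r (pos σ (r ∷ h))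
    ... | true  = []
    ... | false = map (λ r' → r' ∷ r ∷ h)
                    (filterᵇ (λ r' → not (hit r' (pos σ (r ∷ h)))) (neighbours r))

  halfPow : ℕ → ℚ
  halfPow zero = 1ℚ
  halfPow (suc t) = ½ *ℚ halfPow t

  -- P(T > t), robber's start uniform and each step uniform among 2 neighbours
  tailProb : Strategy → ℕ → ℚ
  tailProb σ t = ((+ length (survivors σ t)) / n) *ℚ halfPow t

  -- partial sums  Σ_{t<N} P(T > t)  of  E[T] = Σ_{t≥0} P(T > t)
  partialE : Strategy → ℕ → ℚ
  partialE σ zero = 0ℚ
  partialE σ (suc N) = partialE σ N +ℚ tailProb σ N

module Submission where

open import Defs
open import Data.Bool using (Bool; true; false; not; _∧_; _∨_; T)
open import Data.Bool.Properties using (T?; T-∧; T-∨; T-≡; ∧-zeroʳ; ¬-not; not-injective)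
open import Data.Empty using (⊥; ⊥-elim)
open import Data.Fin using (Fin; toℕ; fromℕ<; _≟_) renaming (zero to fzero; suc to fsuc)
open import Data.Fin.Properties using (toℕ-injective; toℕ<n; toℕ-fromℕ<)
open import Data.List using (List; []; _∷_; _++_; map; concatMap; filterᵇ; length; tabulate; allFin)
open import Data.List.Properties using (filter-++)
open import Data.Nat using (ℕ; zero; suc; _+_; _*_; _∸_; _^_; _≤_; _<_; z≤n; s≤s; _%_; _≤?_; _<ᵇ_; pred; NonZero; ⌊_/2⌋; ⌈_/2⌉)
open import Data.Nat.DivMod using (_mod_; _/_; m<n⇒m%n≡m; [m+n]%n≡m%n; [m+kn]%n≡m%n; %-distribˡ-+; m%n%n≡m%n; m%n<n; m≡m%n+[m/n]*n)
open import Data.Nat.GeneralisedArithmetic using (fold)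
open import Data.Nat.Logarithm using (⌊log₂_⌋; ⌊log₂⌋-mono-≤; ⌊log₂[2^n]⌋≡n)
open import Data.Nat.Properties hiding (_≟_)
open import Algebra.Properties.CommutativeSemigroup +-commutativeSemigroup using (xy∙z≈xz∙y)
open import Data.Nat.Tactic.RingSolver using (solve-∀)
open import Data.Product using (Σ; ∃; _×_; _,_; proj₁; proj₂)
open import Data.Sum using (_⊎_; inj₁; inj₂)
import Data.Sum as Sum
open import Data.Unit using (tt)
open import Data.Vec using (lookup; _∷_; [])
open import Function using (_∘_; id; Equivalence)
open import Relation.Binary using (tri<; tri≈; tri>)
open import Relation.Binary.PropositionalEquality
open import Relation.Nullary using (yes; no)
import Data.Integer as ℤ
import Data.Integer.Properties as ℤ
open import Data.Rational using (ℚ; 0ℚ; ½; toℚᵘ)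
import Data.Rational as ℚ
import Data.Rational.Properties as ℚ
open import Data.Rational.Unnormalised using (ℚᵘ; mkℚᵘ; *≤*; *≡*)
import Data.Rational.Unnormalised as ℚᵘ
import Data.Rational.Unnormalised.Properties as ℚᵘ

-- E T = Σ_t P(T > t), and P(T > t) is the number of robber walks surviving t rounds divided by n 2^t,
-- so both bounds come from counting walks.
-- Lower bound: in s rounds a cop moves at most s steps, so a walk that stays at depth more than s inside
-- one of the two arcs between the cops' starting points at every round s survives. A walk at depth t + 1
-- at round t was at depth more than s at every earlier round s, and for fixed coin flips the endpoint is
-- uniform; hence an arc of length x contributes (x - 3 - 2t)⁺ / n to P(T > t), and summing over t and
-- both arcs (x + y = n) gives E T ≥ (x² + y²) / 4n - O(1) ≥ n / 8 - O(1).
-- Upper bound: the cops start at 0 and ⌊n/2⌋ and, knowing which half the robber started in, walk towards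
-- each other through it; after t rounds a survivor lies in a window of about n/2 - 2t points of its half,
-- so P(T > t) ≤ (n - 4t)⁺ / n + O(1/n), which sums to at most (n + 1) / 8.

indicator : Bool → ℕ
indicator true  = 1
indicator false = 0

indicator≤1 : ∀ b → indicator b ≤ 1
indicator≤1 true  = ≤-refl
indicator≤1 false = z≤n

indicator-T : ∀ {b} → T b → indicator b ≡ 1
indicator-T {true} _ = refl

indicator-mono : ∀ {x y} → (T x → T y) → indicator x ≤ indicator y
indicator-mono {false}         _ = z≤n
indicator-mono {true} {true}   _ = ≤-refl
indicator-mono {true} {false} x⇒y = ⊥-elim (x⇒y _)

indicator-∨ : ∀ x y → (T x → T y → ⊥) → indicator (x ∨ y) ≡ indicator x + indicator y
indicator-∨ true  true  disjoint = ⊥-elim (disjoint _ _)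
indicator-∨ true  false _        = refl
indicator-∨ false _     _        = refl

≤-by-difference : ∀ {a b} k → b ≡ a + k → a ≤ b
≤-by-difference {a} k refl = m≤m+n a k

module _ {A : Set} where

  sumBy : (A → ℕ) → List A → ℕ
  sumBy f []       = 0
  sumBy f (x ∷ xs) = f x + sumBy f xs

  sumBy-++ : ∀ f (xs ys : List A) → sumBy f (xs ++ ys) ≡ sumBy f xs + sumBy f ys
  sumBy-++ f []       ys = refl
  sumBy-++ f (x ∷ xs) ys = trans (cong (f x +_) (sumBy-++ f xs ys)) (sym (+-assoc (f x) _ _))

  sumBy-cong : ∀ {f g : A → ℕ} → (∀ x → f x ≡ g x) → ∀ xs → sumBy f xs ≡ sumBy g xs
  sumBy-cong f≗g []       = refl
  sumBy-cong f≗g (x ∷ xs) = cong₂ _+_ (f≗g x) (sumBy-cong f≗g xs)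

  sumBy-mono : ∀ {f g : A → ℕ} → (∀ x → f x ≤ g x) → ∀ xs → sumBy f xs ≤ sumBy g xs
  sumBy-mono f≤g []       = z≤n
  sumBy-mono f≤g (x ∷ xs) = +-mono-≤ (f≤g x) (sumBy-mono f≤g xs)

  sumBy-+ : ∀ (f g : A → ℕ) xs → sumBy (λ x → f x + g x) xs ≡ sumBy f xs + sumBy g xs
  sumBy-+ f g []       = refl
  sumBy-+ f g (x ∷ xs) = trans (cong (f x + g x +_) (sumBy-+ f g xs)) (swap (f x) (g x) _ _)
    where
    swap : ∀ a b c d → a + b + (c + d) ≡ a + c + (b + d)
    swap = solve-∀

  sumBy-filterᵇ : ∀ (p : A → Bool) xs → length (filterᵇ p xs) ≡ sumBy (indicator ∘ p) xs
  sumBy-filterᵇ p []       = refl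
  sumBy-filterᵇ p (x ∷ xs) with p x
  ... | true  = cong suc (sumBy-filterᵇ p xs)
  ... | false = sumBy-filterᵇ p xs

  filterᵇ-cong : ∀ {p q : A → Bool} → (∀ x → p x ≡ q x) → ∀ xs → filterᵇ p xs ≡ filterᵇ q xs
  filterᵇ-cong {p} {q} p≗q []       = refl
  filterᵇ-cong {p} {q} p≗q (x ∷ xs) with p x | q x | p≗q x
  ... | true  | .true  | refl = cong (x ∷_) (filterᵇ-cong p≗q xs)
  ... | false | .false | refl = filterᵇ-cong p≗q xs

  filterᵇ-none : ∀ (p : A → Bool) xs → (∀ x → p x ≡ false) → filterᵇ p xs ≡ []
  filterᵇ-none p []       _      = refl
  filterᵇ-none p (x ∷ xs) p≡false with p x | p≡false x
  ... | .false | refl = filterᵇ-none p xs p≡false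

module _ {A B : Set} where

  sumBy-map : ∀ (f : B → ℕ) (g : A → B) xs → sumBy f (map g xs) ≡ sumBy (f ∘ g) xs
  sumBy-map f g []       = refl
  sumBy-map f g (x ∷ xs) = cong (f (g x) +_) (sumBy-map f g xs)

  sumBy-concatMap : ∀ (f : B → ℕ) (g : A → List B) xs →
                    sumBy f (concatMap g xs) ≡ sumBy (sumBy f ∘ g) xs
  sumBy-concatMap f g []       = refl
  sumBy-concatMap f g (x ∷ xs) =
    trans (sumBy-++ f (g x) (concatMap g xs)) (cong (sumBy f (g x) +_) (sumBy-concatMap f g xs))

  sumBy-comm : ∀ (f : A → B → ℕ) xs ys →
               sumBy (λ x → sumBy (f x) ys) xs ≡ sumBy (λ y → sumBy (λ x → f x y) xs) ys
  sumBy-comm f []       ys = sym (sumBy-zero ys)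
    where
    sumBy-zero : ∀ ys → sumBy (λ _ → 0) ys ≡ 0
    sumBy-zero []       = refl
    sumBy-zero (_ ∷ ys) = sumBy-zero ys
  sumBy-comm f (x ∷ xs) ys =
    trans (cong (sumBy (f x) ys +_) (sumBy-comm f xs ys))
          (sym (sumBy-+ (f x) (λ y → sumBy (λ x → f x y) xs) ys))

  filterᵇ-map : ∀ (p : B → Bool) (f : A → B) xs → filterᵇ p (map f xs) ≡ map f (filterᵇ (p ∘ f) xs)
  filterᵇ-map p f []       = refl
  filterᵇ-map p f (x ∷ xs) with p (f x)
  ... | true  = cong (f x ∷_) (filterᵇ-map p f xs)
  ... | false = filterᵇ-map p f xs

extendBits : List Bool → List (List Bool)
extendBits ω = (true ∷ ω) ∷ (false ∷ ω) ∷ []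

bitStrings : ℕ → List (List Bool)
bitStrings zero    = [] ∷ []
bitStrings (suc t) = concatMap extendBits (bitStrings t)

sumBy-bitStrings-≥ : ∀ t (F : List Bool → ℕ) (g : ℕ → ℕ) → (∀ ω → g (length ω) ≤ F ω) →
                     2 ^ t * g t ≤ sumBy F (bitStrings t)
sumBy-bitStrings-≥ zero    F g g≤F =
  ≤-trans (≤-reflexive (+-identityʳ (g 0))) (≤-trans (g≤F []) (m≤m+n (F []) 0))
sumBy-bitStrings-≥ (suc t) F g g≤F = begin
  2 ^ suc t * g (suc t)                       ≡⟨ regroup (2 ^ t) (g (suc t)) ⟩
  2 ^ t * (g (suc t) + (g (suc t) + 0))
    ≤⟨ sumBy-bitStrings-≥ t (sumBy F ∘ extendBits) (λ k → g (suc k) + (g (suc k) + 0))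
         (λ ω → +-mono-≤ (g≤F (true ∷ ω)) (+-monoˡ-≤ 0 (g≤F (false ∷ ω)))) ⟩
  sumBy (sumBy F ∘ extendBits) (bitStrings t) ≡⟨ sumBy-concatMap F extendBits (bitStrings t) ⟨
  sumBy F (bitStrings (suc t))                ∎
  where
  open ≤-Reasoning
  regroup : ∀ p g → 2 * p * g ≡ p * (g + (g + 0))
  regroup = solve-∀

sumBy-bitStrings-≤ : ∀ t (F : List Bool → ℕ) (g : ℕ → ℕ) → (∀ ω → F ω ≤ g (length ω)) →
                     sumBy F (bitStrings t) ≤ 2 ^ t * g t
sumBy-bitStrings-≤ zero    F g F≤g =
  ≤-trans (≤-reflexive (+-identityʳ (F []))) (≤-trans (F≤g []) (m≤m+n (g 0) 0))
sumBy-bitStrings-≤ (suc t) F g F≤g = begin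
  sumBy F (bitStrings (suc t))                ≡⟨ sumBy-concatMap F extendBits (bitStrings t) ⟩
  sumBy (sumBy F ∘ extendBits) (bitStrings t)
    ≤⟨ sumBy-bitStrings-≤ t (sumBy F ∘ extendBits) (λ k → g (suc k) + (g (suc k) + 0))
         (λ ω → +-mono-≤ (F≤g (true ∷ ω)) (+-monoˡ-≤ 0 (F≤g (false ∷ ω)))) ⟩
  2 ^ t * (g (suc t) + (g (suc t) + 0))       ≡⟨ regroup (2 ^ t) (g (suc t)) ⟨
  2 ^ suc t * g (suc t)                       ∎
  where
  open ≤-Reasoning
  regroup : ∀ p g → 2 * p * g ≡ p * (g + (g + 0))
  regroup = solve-∀

Σ< : ℕ → (ℕ → ℕ) → ℕ
Σ< zero    f = 0
Σ< (suc N) f = Σ< N f + f N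

Σ<-unfoldˡ : ∀ N f → Σ< (suc N) f ≡ f 0 + Σ< N (f ∘ suc)
Σ<-unfoldˡ zero    f = +-comm 0 (f 0)
Σ<-unfoldˡ (suc N) f = trans (cong (_+ f (suc N)) (Σ<-unfoldˡ N f)) (+-assoc (f 0) _ _)

Σ<-cong : ∀ N {f g : ℕ → ℕ} → (∀ i → i < N → f i ≡ g i) → Σ< N f ≡ Σ< N g
Σ<-cong zero    _   = refl
Σ<-cong (suc N) f≗g = cong₂ _+_ (Σ<-cong N (λ i i<N → f≗g i (m<n⇒m<1+n i<N))) (f≗g N ≤-refl)

Σ<-+ : ∀ N f g → Σ< N (λ i → f i + g i) ≡ Σ< N f + Σ< N g
Σ<-+ zero    f g = refl
Σ<-+ (suc N) f g = trans (cong (_+ (f N + g N)) (Σ<-+ N f g)) (swap (Σ< N f) (Σ< N g) (f N) (g N))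
  where
  swap : ∀ a b c d → a + b + (c + d) ≡ a + c + (b + d)
  swap = solve-∀

Σ<-zero : ∀ N {f} → (∀ i → i < N → f i ≡ 0) → Σ< N f ≡ 0
Σ<-zero zero    _    = refl
Σ<-zero (suc N) f≡0 = cong₂ _+_ (Σ<-zero N (λ i i<N → f≡0 i (m<n⇒m<1+n i<N))) (f≡0 N ≤-refl)

Σ<-monoˡ : ∀ {M N} f → M ≤ N → Σ< M f ≤ Σ< N f
Σ<-monoˡ {M} {zero}  f z≤n = ≤-refl
Σ<-monoˡ {M} {suc N} f M≤1+N with M ≤? N
... | yes M≤N = ≤-trans (Σ<-monoˡ f M≤N) (m≤m+n (Σ< N f) (f N))
... | no  M≰N = ≤-reflexive (cong (λ k → Σ< k f) (≤-antisym M≤1+N (≰⇒> M≰N)))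

Σ<-rotate : ∀ N f → f N ≡ f 0 → Σ< N (f ∘ suc) ≡ Σ< N f
Σ<-rotate N f fN≡f0 = +-cancelˡ-≡ (f 0) _ _ (begin
  f 0 + Σ< N (f ∘ suc) ≡⟨ sym (Σ<-unfoldˡ N f) ⟩
  Σ< N f + f N         ≡⟨ cong (Σ< N f +_) fN≡f0 ⟩
  Σ< N f + f 0         ≡⟨ +-comm (Σ< N f) (f 0) ⟩
  f 0 + Σ< N f         ∎)
  where open ≡-Reasoning

sumBy-tabulate : ∀ {A : Set} k (f : Fin k → A) (F : A → ℕ) (G : ℕ → ℕ) →
                 (∀ j → F (f j) ≡ G (toℕ j)) → sumBy F (tabulate f) ≡ Σ< k G
sumBy-tabulate zero    f F G F∘f≗G∘toℕ = refl
sumBy-tabulate (suc k) f F G F∘f≗G∘toℕ =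
  trans (cong₂ _+_ (F∘f≗G∘toℕ fzero) (sumBy-tabulate k (f ∘ fsuc) F (G ∘ suc) (F∘f≗G∘toℕ ∘ fsuc)))
        (sym (Σ<-unfoldˡ k G))

sumBy-allFin : ∀ k (G : ℕ → ℕ) → sumBy (G ∘ toℕ) (allFin k) ≡ Σ< k G
sumBy-allFin k G = sumBy-tabulate k id (G ∘ toℕ) G (λ _ → refl)

Σ<-≥-interval : ∀ f {c d} → (∀ i → c ≤ i → i < d → f i ≡ 1) → ∀ K → K ≤ d → K ∸ c ≤ Σ< K f
Σ<-≥-interval f {c} f≡1 zero    _ = ≤-reflexive (0∸n≡0 c)
Σ<-≥-interval f {c} f≡1 (suc K) K<d with c ≤? K
... | yes c≤K = begin
  suc K ∸ c          ≡⟨ +-∸-assoc 1 c≤K ⟩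
  suc (K ∸ c)        ≤⟨ s≤s (Σ<-≥-interval f f≡1 K (<⇒≤ K<d)) ⟩
  suc (Σ< K f)       ≡⟨ +-comm 1 (Σ< K f) ⟩
  Σ< K f + 1         ≡⟨ cong (Σ< K f +_) (sym (f≡1 K c≤K K<d)) ⟩
  Σ< (suc K) f       ∎
  where open ≤-Reasoning
... | no c≰K = subst (_≤ Σ< (suc K) f) (sym (m≤n⇒m∸n≡0 (≰⇒> c≰K))) z≤n

Σ<-≤-∸ : ∀ f {c} → (∀ i → f i ≤ 1) → (∀ i → i < c → f i ≡ 0) → ∀ K → Σ< K f ≤ K ∸ c
Σ<-≤-∸ f {c} f≤1 f<c zero    = z≤n
Σ<-≤-∸ f {c} f≤1 f<c (suc K) with c ≤? K
... | yes c≤K = begin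
  Σ< K f + f K  ≤⟨ +-mono-≤ (Σ<-≤-∸ f f≤1 f<c K) (f≤1 K) ⟩
  K ∸ c + 1     ≡⟨ +-comm (K ∸ c) 1 ⟩
  suc (K ∸ c)   ≡⟨ sym (+-∸-assoc 1 c≤K) ⟩
  suc K ∸ c     ∎
  where open ≤-Reasoning
... | no c≰K = begin
  Σ< K f + f K  ≡⟨ cong (Σ< K f +_) (f<c K (≰⇒> c≰K)) ⟩
  Σ< K f + 0    ≡⟨ +-identityʳ _ ⟩
  Σ< K f        ≤⟨ Σ<-≤-∸ f f≤1 f<c K ⟩
  K ∸ c         ≤⟨ ∸-monoˡ-≤ c (n≤1+n K) ⟩
  suc K ∸ c     ∎
  where open ≤-Reasoning

Σ<-≤-interval : ∀ f {c d} → (∀ i → f i ≤ 1) → (∀ i → i < c → f i ≡ 0) →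
                (∀ i → d ≤ i → f i ≡ 0) → ∀ K → Σ< K f ≤ d ∸ c
Σ<-≤-interval f {c} {d} f≤1 f<c f≥d K with K ≤? d
... | yes K≤d = ≤-trans (Σ<-≤-∸ f f≤1 f<c K) (∸-monoˡ-≤ c K≤d)
... | no K≰d = begin
  Σ< K f             ≡⟨ cong (λ k → Σ< k f) (sym (m+[n∸m]≡n d≤K)) ⟩
  Σ< (d + (K ∸ d)) f ≡⟨ Σ<-tail (K ∸ d) ⟩
  Σ< d f             ≤⟨ Σ<-≤-∸ f f≤1 f<c d ⟩
  d ∸ c              ∎
  where
  open ≤-Reasoning
  d≤K : d ≤ K
  d≤K = <⇒≤ (≰⇒> K≰d)
  Σ<-tail : ∀ j → Σ< (d + j) f ≡ Σ< d f
  Σ<-tail zero    = cong (λ k → Σ< k f) (+-identityʳ d)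
  Σ<-tail (suc j) = begin-equality
    Σ< (d + suc j) f         ≡⟨ cong (λ k → Σ< k f) (+-suc d j) ⟩
    Σ< (d + j) f + f (d + j) ≡⟨ cong (Σ< (d + j) f +_) (f≥d (d + j) (m≤m+n d j)) ⟩
    Σ< (d + j) f + 0         ≡⟨ +-identityʳ _ ⟩
    Σ< (d + j) f             ≡⟨ Σ<-tail j ⟩
    Σ< d f                   ∎

inWindow : ℕ → ℕ → ℕ → ℕ → Bool
inWindow lo k hi i = (lo <ᵇ i) ∧ (i + k <ᵇ hi)

inWindow⇒ : ∀ lo k hi i → T (inWindow lo k hi i) → lo < i × i + k < hi
inWindow⇒ lo k hi i p with Equivalence.to T-∧ p
... | p₁ , p₂ = <ᵇ⇒< lo i p₁ , <ᵇ⇒< (i + k) hi p₂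

⇒inWindow : ∀ lo k hi i → lo < i → i + k < hi → T (inWindow lo k hi i)
⇒inWindow lo k hi i p₁ p₂ = Equivalence.from T-∧ (<⇒<ᵇ p₁ , <⇒<ᵇ p₂)

count-inWindow : ∀ lo k hi K → Σ< K (indicator ∘ inWindow lo k hi) ≤ hi ∸ (lo + k + 1)
count-inWindow lo k hi K = ≤-trans (Σ<-≤-interval f (indicator≤1 ∘ inWindow lo k hi) below above K)
                                   (≤-reflexive (trans (∸-+-assoc hi k (suc lo)) (cong (hi ∸_) (regroup k lo))))
  where
  f : ℕ → ℕ
  f = indicator ∘ inWindow lo k hi
  rejectᵇ : ∀ {a b} → b ≤ a → (a <ᵇ b) ≡ false
  rejectᵇ {a} {b} b≤a = ¬-not λ a<ᵇb → <⇒≱ (<ᵇ⇒< a b (Equivalence.from T-≡ a<ᵇb)) b≤a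
  below : ∀ i → i < suc lo → f i ≡ 0
  below i (s≤s i≤lo) = cong (λ z → indicator (z ∧ (i + k <ᵇ hi))) (rejectᵇ i≤lo)
  above : ∀ i → hi ∸ k ≤ i → f i ≡ 0
  above i hi∸k≤i =
    trans (cong (λ z → indicator ((lo <ᵇ i) ∧ z)) (rejectᵇ hi≤i+k)) (cong indicator (∧-zeroʳ (lo <ᵇ i)))
    where
    hi≤i+k : hi ≤ i + k
    hi≤i+k = ≤-trans (m≤n+m∸n hi k) (≤-trans (+-monoʳ-≤ k hi∸k≤i) (≤-reflexive (+-comm k i)))
  regroup : ∀ k lo → k + suc lo ≡ lo + k + 1
  regroup = solve-∀

inArc : ℕ → ℕ → ℕ → ℕ → Bool
inArc L R t = inWindow (L + t) t R

inArc-disjoint : ∀ L M R t ρ → T (inArc L M t ρ) → T (inArc M R t ρ) → ⊥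
inArc-disjoint L M R t ρ p q = <-irrefl refl (<-trans (≤-<-trans (m≤m+n ρ t) (proj₂ (inWindow⇒ (L + t) t M ρ p)))
                                                      (≤-<-trans (m≤m+n M t) (proj₁ (inWindow⇒ (M + t) t R ρ q))))

inArc-weaken : ∀ L R t ρ → T (inArc L R (suc t) ρ) → T (inArc L R t ρ)
inArc-weaken L R t ρ p with inWindow⇒ (L + suc t) (suc t) R ρ p
... | L+t<ρ , ρ+t<R =
  ⇒inWindow (L + t) t R ρ (<-trans (+-monoʳ-< L (n<1+n t)) L+t<ρ) (<-trans (+-monoʳ-< ρ (n<1+n t)) ρ+t<R)

unmove : Bool → ℕ → ℕ
unmove true  ρ = ρ ∸ 1
unmove false ρ = suc ρ

inArc-unmove : ∀ L R t ρ → T (inArc L R (suc t) ρ) → ∀ b → T (inArc L R t (unmove b ρ))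
inArc-unmove L R t ρ p b with inWindow⇒ (L + suc t) (suc t) R ρ p
inArc-unmove L R t ρ p true  | L+t<ρ , ρ+t<R =
  ⇒inWindow (L + t) t R (ρ ∸ 1) (∸-monoˡ-≤ 1 (subst (λ k → suc k ≤ ρ) (+-suc L t) L+t<ρ))
            (≤-<-trans (+-monoˡ-≤ t (m∸n≤m ρ 1)) (<-trans (+-monoʳ-< ρ (n<1+n t)) ρ+t<R))
inArc-unmove L R t ρ p false | L+t<ρ , ρ+t<R =
  ⇒inWindow (L + t) t R (suc ρ) (<-trans (<-trans (+-monoʳ-< L (n<1+n t)) L+t<ρ) (n<1+n ρ))
            (subst (_< R) (+-suc ρ t) ρ+t<R)

count-inArc : ∀ N c k L R → c ≤ L → R ≤ c + N →
              R ∸ (L + k + k + 1) ≤ Σ< N (λ i → indicator (inArc L R k (c + i)))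
count-inArc N c k L R c≤L R≤c+N with L + k + k + 1 ≤? R
... | no short =
  subst (_≤ Σ< N (λ i → indicator (inArc L R k (c + i)))) (sym (m≤n⇒m∸n≡0 (<⇒≤ (≰⇒> short)))) z≤n
... | yes long with m≤n⇒∃[o]m+o≡n c≤L
... | d , refl with m≤n⇒∃[o]m+o≡n long
... | e , refl = begin
  c + d + k + k + 1 + e ∸ (c + d + k + k + 1) ≡⟨ m+n∸m≡n (c + d + k + k + 1) e ⟩
  e                                          ≡⟨ m+n∸m≡n lo e ⟨
  lo + e ∸ lo                                ≤⟨ Σ<-≥-interval f deep (lo + e) ≤-refl ⟩
  Σ< (lo + e) f                              ≤⟨ Σ<-monoˡ f lo+e≤N ⟩
  Σ< N f                                     ∎
  where
  open ≤-Reasoning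
  lo : ℕ
  lo = d + k + 1
  f : ℕ → ℕ
  f i = indicator (inArc (c + d) (c + d + k + k + 1 + e) k (c + i))
  deep : ∀ i → lo ≤ i → i < lo + e → f i ≡ 1
  deep i lo≤i i<lo+e = indicator-T (⇒inWindow (c + d + k) k _ (c + i)
    (≤-trans (≤-reflexive (regroup c d k)) (+-monoʳ-≤ c lo≤i))
    (≤-trans (+-monoˡ-< k (+-monoʳ-< c i<lo+e)) (≤-reflexive (regroup2 c d k e))))
    where
    regroup : ∀ c d k → suc (c + d + k) ≡ c + (d + k + 1)
    regroup = solve-∀
    regroup2 : ∀ c d k e → c + (d + k + 1 + e) + k ≡ c + d + k + k + 1 + e
    regroup2 = solve-∀
  lo+e≤N : lo + e ≤ N
  lo+e≤N = +-cancelˡ-≤ c (lo + e) N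
    (≤-trans (≤-reflexive (regroup c d k e))
             (≤-trans (+-monoˡ-≤ e (+-monoˡ-≤ 1 (m≤m+n (c + d + k) k))) R≤c+N))
    where
    regroup : ∀ c d k e → c + (d + k + 1 + e) ≡ c + d + k + 1 + e
    regroup = solve-∀

initialBonus : ℕ → ℕ
initialBonus zero    = 1
initialBonus (suc _) = 0

window : ℕ → ℕ → List Bool → ℕ → Bool
window L R []          = inWindow L 0 R
window L R (true ∷ ω)  = inWindow (L + suc (suc (length ω))) (suc (length ω)) R
window L R (false ∷ ω) = inWindow (L + suc (length ω)) (suc (suc (length ω))) R

count-window : ∀ L R ω K →
               Σ< K (indicator ∘ window L R ω) ≤ initialBonus (length ω) + (R ∸ L ∸ 2 ∸ (length ω + length ω))
count-window L R []          K =
  ≤-trans (count-inWindow L 0 R K) (subst (_≤ 1 + (R ∸ L ∸ 2)) R∸L∸1≡R∸[L+0+1] (x∸1≤1+[x∸2] (R ∸ L)))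
  where
  R∸L∸1≡R∸[L+0+1] : R ∸ L ∸ 1 ≡ R ∸ (L + 0 + 1)
  R∸L∸1≡R∸[L+0+1] = trans (∸-+-assoc R L 1) (cong (λ k → R ∸ (k + 1)) (sym (+-identityʳ L)))
  x∸1≤1+[x∸2] : ∀ x → x ∸ 1 ≤ 1 + (x ∸ 2)
  x∸1≤1+[x∸2] zero          = z≤n
  x∸1≤1+[x∸2] (suc zero)    = z≤n
  x∸1≤1+[x∸2] (suc (suc x)) = ≤-refl
count-window L R (true ∷ ω)  K =
  ≤-trans (count-inWindow (L + suc (suc l)) (suc l) R K) (≤-reflexive (sym (depth L R l)))
  where
  l : ℕ
  l = length ω
  depth : ∀ L R l → R ∸ L ∸ 2 ∸ (suc l + suc l) ≡ R ∸ (L + suc (suc l) + suc l + 1)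
  depth L R l = trans (∸-+-assoc (R ∸ L) 2 _) (trans (∸-+-assoc R L _) (cong (R ∸_) (regroup L l)))
    where
    regroup : ∀ L l → L + (2 + (suc l + suc l)) ≡ L + suc (suc l) + suc l + 1
    regroup = solve-∀
count-window L R (false ∷ ω) K =
  ≤-trans (count-inWindow (L + suc l) (suc (suc l)) R K) (≤-reflexive (sym (depth L R l)))
  where
  l : ℕ
  l = length ω
  depth : ∀ L R l → R ∸ L ∸ 2 ∸ (suc l + suc l) ≡ R ∸ (L + suc l + suc (suc l) + 1)
  depth L R l = trans (∸-+-assoc (R ∸ L) 2 _) (trans (∸-+-assoc R L _) (cong (R ∸_) (regroup L l)))
    where
    regroup : ∀ L l → L + (2 + (suc l + suc l)) ≡ L + suc l + suc (suc l) + 1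
    regroup = solve-∀

Σ<-initialBonus : ∀ N → Σ< N initialBonus ≤ 1
Σ<-initialBonus zero    = z≤n
Σ<-initialBonus (suc N) = ≤-reflexive (trans (Σ<-unfoldˡ N initialBonus) (cong suc (Σ<-zero N (λ _ _ → refl))))

staircase : ℕ → ℕ → ℕ
staircase e N = Σ< N (λ t → e ∸ (t + t))

staircase-step : ∀ e N → staircase (2 + e) (suc N) ≡ 2 + e + staircase e N
staircase-step e N =
  trans (Σ<-unfoldˡ N _) (cong (2 + e +_) (Σ<-cong N (λ t _ → cong (suc e ∸_) (+-suc t t))))

staircase-zero : ∀ N → staircase 0 N ≡ 0
staircase-zero N = Σ<-zero N (λ t _ → 0∸n≡0 (t + t))

staircase-one : ∀ N → staircase 1 N ≤ 1
staircase-one zero    = z≤n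
staircase-one (suc N) = ≤-reflexive (trans (Σ<-unfoldˡ N _) (cong suc (Σ<-zero N (λ t _ → 0∸n≡0 (t + suc t)))))

square≤4*staircase : ∀ e N → e ≤ N → e * e ≤ 4 * staircase e N
square≤4*staircase zero          N       _         = z≤n
square≤4*staircase (suc zero)    (suc N) _         =
  ≤-trans (≤-trans (m≤m+n 1 _) (≤-reflexive (sym (Σ<-unfoldˡ N _)))) (m≤n*m _ 4)
square≤4*staircase (suc (suc e)) (suc N) (s≤s e<N) = begin
  (2 + e) * (2 + e)              ≤⟨ ≤-by-difference 4 (expand e) ⟩
  4 * (2 + e) + e * e            ≤⟨ +-monoʳ-≤ (4 * (2 + e)) (square≤4*staircase e N (<⇒≤ e<N)) ⟩
  4 * (2 + e) + 4 * staircase e N ≡⟨ sym (*-distribˡ-+ 4 (2 + e) (staircase e N)) ⟩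
  4 * (2 + e + staircase e N)    ≡⟨ cong (4 *_) (sym (staircase-step e N)) ⟩
  4 * staircase (2 + e) (suc N)  ∎
  where
  open ≤-Reasoning
  expand : ∀ e → 4 * (2 + e) + e * e ≡ (2 + e) * (2 + e) + 4
  expand = solve-∀

4*staircase+4≤square : ∀ e N → 4 * staircase e N + 4 ≤ (e + 2) * (e + 2)
4*staircase+4≤square zero          N       = ≤-reflexive (cong (λ s → 4 * s + 4) (staircase-zero N))
4*staircase+4≤square (suc zero)    N       =
  ≤-trans (+-monoˡ-≤ 4 (*-monoʳ-≤ 4 (staircase-one N))) (≤-by-difference 1 refl)
4*staircase+4≤square (suc (suc e)) zero    = ≤-by-difference (e * e + 8 * e + 12) (expand e)
  where
  expand : ∀ e → (2 + e + 2) * (2 + e + 2) ≡ 4 * 0 + 4 + (e * e + 8 * e + 12)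
  expand = solve-∀
4*staircase+4≤square (suc (suc e)) (suc N) = begin
  4 * staircase (2 + e) (suc N) + 4    ≡⟨ cong (λ s → 4 * s + 4) (staircase-step e N) ⟩
  4 * (2 + e + staircase e N) + 4      ≡⟨ regroup e (staircase e N) ⟩
  4 * (2 + e) + (4 * staircase e N + 4) ≤⟨ +-monoʳ-≤ (4 * (2 + e)) (4*staircase+4≤square e N) ⟩
  4 * (2 + e) + (e + 2) * (e + 2)      ≤⟨ ≤-by-difference 4 (expand e) ⟩
  (2 + e + 2) * (2 + e + 2)            ∎
  where
  open ≤-Reasoning
  regroup : ∀ e s → 4 * (2 + e + s) + 4 ≡ 4 * (2 + e) + (4 * s + 4)
  regroup = solve-∀
  expand : ∀ e → (2 + e + 2) * (2 + e + 2) ≡ 4 * (2 + e) + (e + 2) * (e + 2) + 4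
  expand = solve-∀

square-+≤ : ∀ a b → (a + b) * (a + b) ≤ 2 * (a * a + b * b)
square-+≤ a b with ≤-total a b
... | inj₁ a≤b with m≤n⇒∃[o]m+o≡n a≤b
...   | d , refl = ≤-by-difference (d * d) (expand a d)
  where
  expand : ∀ a d → 2 * (a * a + (a + d) * (a + d)) ≡ (a + (a + d)) * (a + (a + d)) + d * d
  expand = solve-∀
square-+≤ a b | inj₂ b≤a with m≤n⇒∃[o]m+o≡n b≤a
...   | d , refl = ≤-by-difference (d * d) (expand b d)
  where
  expand : ∀ b d → 2 * ((b + d) * (b + d) + b * b) ≡ ((b + d) + b) * ((b + d) + b) + d * d
  expand = solve-∀

staircase-pair-lower : ∀ x y N → x ≤ N → y ≤ N →
  (x + y) * (x + y) ≤ 8 * (staircase (x ∸ 3) N + staircase (y ∸ 3) N) + 12 * (x + y)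
staircase-pair-lower x y N x≤N y≤N = begin
  (x + y) * (x + y)                      ≤⟨ s²≤e²+12s (x + y) e (x+y∸6≤e) ⟩
  e * e + 12 * (x + y)                   ≤⟨ +-monoˡ-≤ (12 * (x + y)) (square-+≤ (x ∸ 3) (y ∸ 3)) ⟩
  2 * ((x ∸ 3) * (x ∸ 3) + (y ∸ 3) * (y ∸ 3)) + 12 * (x + y)
    ≤⟨ +-monoˡ-≤ (12 * (x + y))
         (*-monoʳ-≤ 2 (+-mono-≤ (square≤4*staircase (x ∸ 3) N (≤-trans (m∸n≤m x 3) x≤N))
                                (square≤4*staircase (y ∸ 3) N (≤-trans (m∸n≤m y 3) y≤N)))) ⟩
  2 * (4 * hx + 4 * hy) + 12 * (x + y)   ≡⟨ cong (_+ 12 * (x + y)) (regroup hx hy) ⟩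
  8 * (hx + hy) + 12 * (x + y)           ∎
  where
  open ≤-Reasoning
  e : ℕ
  e = (x ∸ 3) + (y ∸ 3)
  hx : ℕ
  hx = staircase (x ∸ 3) N
  hy : ℕ
  hy = staircase (y ∸ 3) N
  regroup : ∀ a b → 2 * (4 * a + 4 * b) ≡ 8 * (a + b)
  regroup = solve-∀
  x+y∸6≤e : (x + y) ∸ 6 ≤ e
  x+y∸6≤e = ≤-trans (∸-monoˡ-≤ 6 x+y≤6+e) (≤-reflexive (m+n∸m≡n 6 e))
    where
    x+y≤6+e : x + y ≤ 6 + e
    x+y≤6+e = ≤-trans (+-mono-≤ (m≤n+m∸n x 3) (m≤n+m∸n y 3)) (≤-reflexive (regroup3 (x ∸ 3) (y ∸ 3)))
      where
      regroup3 : ∀ a b → 3 + a + (3 + b) ≡ 6 + (a + b)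
      regroup3 = solve-∀
  s²≤e²+12s : ∀ s e → s ∸ 6 ≤ e → s * s ≤ e * e + 12 * s
  s²≤e²+12s s e s∸6≤e with s ≤? e
  ... | yes s≤e = ≤-trans (*-mono-≤ s≤e s≤e) (m≤m+n (e * e) (12 * s))
  ... | no  s≰e = begin
    s * s               ≤⟨ *-monoʳ-≤ s s≤e+6 ⟩
    s * (e + 6)         ≤⟨ ≤-reflexive (expand s e) ⟩
    s * e + 6 * s       ≤⟨ +-monoˡ-≤ (6 * s) (*-monoˡ-≤ e s≤e+6) ⟩
    (e + 6) * e + 6 * s ≡⟨ expand2 e s ⟩
    e * e + (6 * e + 6 * s) ≤⟨ +-monoʳ-≤ (e * e) (+-monoˡ-≤ (6 * s) (*-monoʳ-≤ 6 (<⇒≤ (≰⇒> s≰e)))) ⟩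
    e * e + (6 * s + 6 * s) ≡⟨ expand3 e s ⟩
    e * e + 12 * s      ∎
    where
    s≤e+6 : s ≤ e + 6
    s≤e+6 = ≤-trans (m≤n+m∸n s 6) (≤-trans (+-monoʳ-≤ 6 s∸6≤e) (≤-reflexive (+-comm 6 e)))
    expand : ∀ s e → s * (e + 6) ≡ s * e + 6 * s
    expand = solve-∀
    expand2 : ∀ e s → (e + 6) * e + 6 * s ≡ e * e + (6 * e + 6 * s)
    expand2 = solve-∀
    expand3 : ∀ e s → e * e + (6 * s + 6 * s) ≡ e * e + 12 * s
    expand3 = solve-∀

staircase-pair-upper : ∀ p q N → 2 ≤ p → 2 ≤ q →
  8 * (2 + staircase (p ∸ 2) N + staircase (q ∸ 2) N) ≤ 2 * (p * p) + 2 * (q * q)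
staircase-pair-upper p q N 2≤p 2≤q = begin
  8 * (2 + hp + hq)                                     ≡⟨ regroup hp hq ⟩
  2 * (4 * hp + 4) + 2 * (4 * hq + 4)
    ≤⟨ +-mono-≤ (*-monoʳ-≤ 2 (4*staircase+4≤square (p ∸ 2) N)) (*-monoʳ-≤ 2 (4*staircase+4≤square (q ∸ 2) N)) ⟩
  2 * ((p ∸ 2 + 2) * (p ∸ 2 + 2)) + 2 * ((q ∸ 2 + 2) * (q ∸ 2 + 2))
    ≡⟨ cong₂ (λ a b → 2 * (a * a) + 2 * (b * b)) (m∸n+n≡m 2≤p) (m∸n+n≡m 2≤q) ⟩
  2 * (p * p) + 2 * (q * q)                             ∎
  where
  open ≤-Reasoning
  hp : ℕ
  hp = staircase (p ∸ 2) N
  hq : ℕ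
  hq = staircase (q ∸ 2) N
  regroup : ∀ a b → 8 * (2 + a + b) ≡ 2 * (4 * a + 4) + 2 * (4 * b + 4)
  regroup = solve-∀

⌈n/2⌉≡⌊n/2⌋⊎1+⌊n/2⌋ : ∀ k → ⌈ k /2⌉ ≡ ⌊ k /2⌋ ⊎ ⌈ k /2⌉ ≡ suc ⌊ k /2⌋
⌈n/2⌉≡⌊n/2⌋⊎1+⌊n/2⌋ zero          = inj₁ refl
⌈n/2⌉≡⌊n/2⌋⊎1+⌊n/2⌋ (suc zero)    = inj₂ refl
⌈n/2⌉≡⌊n/2⌋⊎1+⌊n/2⌋ (suc (suc k)) = Sum.map (cong suc) (cong suc) (⌈n/2⌉≡⌊n/2⌋⊎1+⌊n/2⌋ k)

halves-squares : ∀ k → 2 * (⌊ k /2⌋ * ⌊ k /2⌋) + 2 * (⌈ k /2⌉ * ⌈ k /2⌉) ≤ k * (k + 1)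
halves-squares k = subst (λ j → 2 * (⌊ k /2⌋ * ⌊ k /2⌋) + 2 * (⌈ k /2⌉ * ⌈ k /2⌉) ≤ j * (j + 1))
                         (⌊n/2⌋+⌈n/2⌉≡n k) (balanced ⌊ k /2⌋ ⌈ k /2⌉ (⌈n/2⌉≡⌊n/2⌋⊎1+⌊n/2⌋ k))
  where
  balanced : ∀ p q → q ≡ p ⊎ q ≡ suc p → 2 * (p * p) + 2 * (q * q) ≤ (p + q) * (p + q + 1)
  balanced p q (inj₁ refl) = ≤-by-difference (2 * p) (expand p)
    where
    expand : ∀ p → (p + p) * (p + p + 1) ≡ 2 * (p * p) + 2 * (p * p) + 2 * p
    expand = solve-∀
  balanced p q (inj₂ refl) = ≤-by-difference (2 * p) (expand p)
    where
    expand : ∀ p → (p + suc p) * (p + suc p + 1) ≡ 2 * (p * p) + 2 * (suc p * suc p) + 2 * p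
    expand = solve-∀

-- a / (1 + k), in the shifted-denominator representation of ℚᵘ
fracᵘ : ℕ → ℕ → ℚᵘ
fracᵘ a k = mkℚᵘ (ℤ.+ a) k

fracᵘ-mono : ∀ a k b l → a * suc l ≤ b * suc k → fracᵘ a k ℚᵘ.≤ fracᵘ b l
fracᵘ-mono a k b l le = *≤* (subst₂ ℤ._≤_ (ℤ.pos-* a (suc l)) (ℤ.pos-* b (suc k)) (ℤ.+≤+ le))

fracᵘ-cong : ∀ a k b l → a * suc l ≡ b * suc k → fracᵘ a k ℚᵘ.≃ fracᵘ b l
fracᵘ-cong a k b l eq = *≡* (trans (sym (ℤ.pos-* a (suc l))) (trans (cong ℤ.+_ eq) (ℤ.pos-* b (suc k))))

fracᵘ-+ : ∀ a k b l → fracᵘ a k ℚᵘ.+ fracᵘ b l ≡ fracᵘ (a * suc l + b * suc k) (l + k * suc l)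
fracᵘ-+ a k b l = cong (λ z → mkℚᵘ z (l + k * suc l))
  (trans (cong₂ ℤ._+_ (sym (ℤ.pos-* a (suc l))) (sym (ℤ.pos-* b (suc k)))) (sym (ℤ.pos-+ (a * suc l) (b * suc k))))

fracᵘ-* : ∀ a k b l → fracᵘ a k ℚᵘ.* fracᵘ b l ≡ fracᵘ (a * b) (l + k * suc l)
fracᵘ-* a k b l = cong (λ z → mkℚᵘ z (l + k * suc l)) (sym (ℤ.pos-* a b))

fracᵘ-+-sameDenominator : ∀ a b k → fracᵘ a k ℚᵘ.+ fracᵘ b k ℚᵘ.≃ fracᵘ (a + b) k
fracᵘ-+-sameDenominator a b k =
  ℚᵘ.≃-trans (ℚᵘ.≃-reflexive (fracᵘ-+ a k b k)) (fracᵘ-cong _ _ _ _ (expand a b k))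
  where
  expand : ∀ a b k → (a * suc k + b * suc k) * suc k ≡ (a + b) * suc (k + k * suc k)
  expand = solve-∀

toℚᵘ-/ : ∀ a k → toℚᵘ ((ℤ.+ a) ℚ./ suc k) ℚᵘ.≃ fracᵘ a k
toℚᵘ-/ a k = ℚ.toℚᵘ-fromℚᵘ (fracᵘ a k)

ℚ-sub-sub-≤ : ∀ {x y P ε} → x ℚ.≤ P ℚ.+ y → 0ℚ ℚ.< ε → x ℚ.- y ℚ.- ε ℚ.≤ P
ℚ-sub-sub-≤ {x} {y} {P} {ε} x≤P+y ε>0 = begin
  x ℚ.- y ℚ.- ε       ≤⟨ ℚ.+-monoʳ-≤ (x ℚ.- y) (ℚ.neg-antimono-≤ (ℚ.<⇒≤ ε>0)) ⟩
  x ℚ.- y ℚ.+ 0ℚ      ≡⟨ ℚ.+-identityʳ (x ℚ.- y) ⟩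
  x ℚ.- y             ≤⟨ ℚ.+-monoˡ-≤ (ℚ.- y) x≤P+y ⟩
  P ℚ.+ y ℚ.- y       ≡⟨ ℚ.+-assoc P y (ℚ.- y) ⟩
  P ℚ.+ (y ℚ.- y)     ≡⟨ cong (P ℚ.+_) (ℚ.+-inverseʳ y) ⟩
  P ℚ.+ 0ℚ            ≡⟨ ℚ.+-identityʳ P ⟩
  P                   ∎
  where open ℚ.≤-Reasoning

-- With 2 ≤ L, the term 6 L / 8 absorbs the additive constant 12 / 8: the logarithm in the bound is slack.
lower-bound-ℚ : ∀ m S L ε P → suc m * suc m ≤ 8 * S + 12 * suc m → 2 ≤ L → 0ℚ ℚ.< ε →
                fracᵘ S m ℚᵘ.≤ toℚᵘ P →
                (((ℤ.+ suc m) ℚ./ 8) ℚ.- ((ℤ.+ (6 * L)) ℚ./ 8)) ℚ.- ε ℚ.≤ P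
lower-bound-ℚ m S L ε P n²≤8S+12n 2≤L ε>0 S/n≤P = ℚ-sub-sub-≤ (ℚ.toℚᵘ-cancel-≤ (begin
  toℚᵘ ((ℤ.+ n) ℚ./ 8)                    ≃⟨ toℚᵘ-/ n 7 ⟩
  fracᵘ n 7                             ≤⟨ fracᵘ-mono n 7 _ _ cross-multiplied ⟩
  fracᵘ (S * 8 + 6 * L * n) (7 + m * 8) ≡⟨ fracᵘ-+ S m (6 * L) 7 ⟨
  fracᵘ S m ℚᵘ.+ fracᵘ (6 * L) 7
    ≤⟨ ℚᵘ.+-mono-≤ S/n≤P (ℚᵘ.≤-reflexive (ℚᵘ.≃-sym (toℚᵘ-/ (6 * L) 7))) ⟩
  toℚᵘ P ℚᵘ.+ toℚᵘ y                    ≃⟨ ℚ.toℚᵘ-homo-+ P y ⟨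
  toℚᵘ (P ℚ.+ y)                        ∎)) ε>0
  where
  open ℚᵘ.≤-Reasoning
  n : ℕ
  n = suc m
  y : ℚ
  y = (ℤ.+ (6 * L)) ℚ./ 8
  cross-multiplied : n * suc (7 + m * 8) ≤ (S * 8 + 6 * L * n) * 8
  cross-multiplied =
    ≤-trans (≤-reflexive (expand m))
      (≤-trans (*-monoʳ-≤ 8 (≤-trans n²≤8S+12n (+-monoʳ-≤ (8 * S) (*-monoˡ-≤ n (*-monoʳ-≤ 6 2≤L)))))
               (≤-reflexive (expand2 S L n)))
    where
    expand : ∀ m → suc m * suc (7 + m * 8) ≡ 8 * (suc m * suc m)
    expand = solve-∀
    expand2 : ∀ S L n → 8 * (8 * S + 6 * L * n) ≡ (S * 8 + 6 * L * n) * 8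
    expand2 = solve-∀

≤-+-positive : ∀ {P z ε} → P ℚ.≤ z → 0ℚ ℚ.< ε → P ℚ.≤ z ℚ.+ ε
≤-+-positive {P} {z} {ε} P≤z ε>0 =
  ℚ.≤-trans P≤z (ℚ.≤-trans (ℚ.≤-reflexive (sym (ℚ.+-identityʳ z))) (ℚ.+-monoʳ-≤ z (ℚ.<⇒≤ ε>0)))

upper-bound-ℚ : ∀ m U P → 8 * U ≤ suc m * (suc m + 1) → toℚᵘ P ℚᵘ.≤ fracᵘ U m →
                P ℚ.≤ (ℤ.+ (suc m + 1)) ℚ./ 8
upper-bound-ℚ m U P 8U≤n[n+1] P≤U/n = ℚ.toℚᵘ-cancel-≤ (begin
  toℚᵘ P                         ≤⟨ P≤U/n ⟩
  fracᵘ U m                      ≤⟨ fracᵘ-mono U m (suc m + 1) 7 cross-multiplied ⟩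
  fracᵘ (suc m + 1) 7            ≃⟨ toℚᵘ-/ (suc m + 1) 7 ⟨
  toℚᵘ ((ℤ.+ (suc m + 1)) ℚ./ 8)   ∎)
  where
  open ℚᵘ.≤-Reasoning
  cross-multiplied : U * 8 ≤ (suc m + 1) * suc m
  cross-multiplied = ≤-trans (≤-reflexive (*-comm U 8)) (≤-trans 8U≤n[n+1] (≤-reflexive (*-comm (suc m) (suc m + 1))))

module CycleArithmetic (m : ℕ) where

  n : ℕ
  n = suc m

  open Cycle n

  [a%n+b]%n≡[a+b]%n : ∀ a b → (a % n + b) % n ≡ (a + b) % n
  [a%n+b]%n≡[a+b]%n a b = begin
    (a % n + b) % n          ≡⟨ %-distribˡ-+ (a % n) b n ⟩
    (a % n % n + b % n) % n  ≡⟨ cong (λ z → (z + b % n) % n) (m%n%n≡m%n a n) ⟩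
    (a % n + b % n) % n      ≡⟨ %-distribˡ-+ a b n ⟨
    (a + b) % n              ∎
    where open ≡-Reasoning

  toℕ-mod : ∀ a → toℕ (a mod n) ≡ a % n
  toℕ-mod a = toℕ-fromℕ< (m%n<n a n)

  toℕ%n : ∀ (v : Fin n) → toℕ v % n ≡ toℕ v
  toℕ%n v = m<n⇒m%n≡m (toℕ<n v)

  mod-cong : ∀ a b → a % n ≡ b % n → a mod n ≡ b mod n
  mod-cong a b eq = toℕ-injective (trans (toℕ-mod a) (trans eq (sym (toℕ-mod b))))

  toℕ-right : ∀ v → toℕ (right v) ≡ suc (toℕ v) % n
  toℕ-right v = toℕ-mod (suc (toℕ v))

  toℕ-left : ∀ v → toℕ (left v) ≡ (toℕ v + m) % n
  toℕ-left v = toℕ-mod (toℕ v + m)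

  toℕ-right-< : ∀ v → suc (toℕ v) < n → toℕ (right v) ≡ suc (toℕ v)
  toℕ-right-< v 1+v<n = trans (toℕ-right v) (m<n⇒m%n≡m 1+v<n)

  toℕ-left-> : ∀ v → 0 < toℕ v → toℕ (left v) ≡ toℕ v ∸ 1
  toℕ-left-> v 0<v with toℕ v | toℕ<n v | toℕ-left v
  ... | suc k | 1+k<n | left≡ = trans left≡ (begin
    (suc k + m) % n ≡⟨ cong (_% n) (+-suc k m) ⟨
    (k + n) % n     ≡⟨ [m+n]%n≡m%n k n ⟩
    k % n           ≡⟨ m<n⇒m%n≡m (<-trans (n<1+n k) 1+k<n) ⟩
    k               ∎)
    where open ≡-Reasoning

  %-≢-within-period : ∀ a b → b < a → a < b + n → a % n ≢ b % n
  %-≢-within-period a b b<a a<b+n a≡b = <⇒≱ a<b+n b+n≤a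
    where
    r : ℕ
    r = b % n
    a≡r+qn : a ≡ r + (a / n) * n
    a≡r+qn = trans (m≡m%n+[m/n]*n a n) (cong (_+ (a / n) * n) a≡b)
    b≡r+qn : b ≡ r + (b / n) * n
    b≡r+qn = m≡m%n+[m/n]*n b n
    qb<qa : b / n < a / n
    qb<qa = *-cancelʳ-< n (b / n) (a / n) (+-cancelˡ-< r _ _ (subst₂ _<_ b≡r+qn a≡r+qn b<a))
    b+n≤a : b + n ≤ a
    b+n≤a = subst₂ _≤_ (cong (_+ n) (sym b≡r+qn)) (sym a≡r+qn)
              (subst (_≤ r + (a / n) * n) (sym (+-assoc r ((b / n) * n) n))
                (+-monoʳ-≤ r (subst (_≤ (a / n) * n) (+-comm n ((b / n) * n)) (*-monoˡ-≤ n qb<qa))))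

  %-injective-window : ∀ {w k j} → w ≤ k → k < w + n → w ≤ j → j < w + n → k % n ≡ j % n → k ≡ j
  %-injective-window {w} {k} {j} w≤k k<w+n w≤j j<w+n k≡j with <-cmp k j
  ... | tri< k<j _ _ = ⊥-elim (%-≢-within-period j k k<j (<-≤-trans j<w+n (+-monoˡ-≤ n w≤k)) (sym k≡j))
  ... | tri≈ _ k≡j _ = k≡j
  ... | tri> _ _ j<k = ⊥-elim (%-≢-within-period k j j<k (<-≤-trans k<w+n (+-monoˡ-≤ n w≤j)) k≡j)

module CopMoves (m : ℕ) where

  open CycleArithmetic m
  open Cycle n

  hit-false : ∀ v c → (∀ j → lookup c j ≢ v) → hit v c ≡ false
  hit-false v c ≢v with lookup c fzero ≟ v | lookup c (fsuc fzero) ≟ v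
  ... | yes e | _     = ⊥-elim (≢v fzero e)
  ... | no _  | yes e = ⊥-elim (≢v (fsuc fzero) e)
  ... | no _  | no _  = refl

  hit-false⇒≢ : ∀ v c → hit v c ≡ false → ∀ j → lookup c j ≢ v
  hit-false⇒≢ v c miss j c≡v with lookup c fzero ≟ v | lookup c (fsuc fzero) ≟ v | miss
  hit-false⇒≢ v c miss fzero        c≡v | no ≢v | _     | _ = ≢v c≡v
  hit-false⇒≢ v c miss (fsuc fzero) c≡v | no _  | no ≢v | _ = ≢v c≡v

  -- c is x - s + offset (mod n), with the subtraction replaced by adding m s ≡ - s (mod n).
  record Reachable (x : Fin n) (s : ℕ) (c : Fin n) : Set where
    constructor reachable
    field
      offset    : ℕ
      offset≤2s : offset ≤ s + s
      placed    : toℕ c ≡ (toℕ x + m * s + offset) % n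

  reachable-zero : ∀ x → Reachable x 0 x
  reachable-zero x = reachable 0 z≤n (sym (trans (cong (_% n) (x+m*0+0≡x (toℕ x))) (toℕ%n x)))
    where
    x+m*0+0≡x : ∀ a → a + m * 0 + 0 ≡ a
    x+m*0+0≡x a rewrite *-zeroʳ m | +-identityʳ a | +-identityʳ a = refl

  reachable-step : ∀ {x s c c′} → Reachable x s c → CopStep c c′ → Reachable x (suc s) c′
  reachable-step {x} {s} {c} (reachable i i≤2s eq) (inj₁ refl) =
    reachable (suc i) (≤-trans (s≤s i≤2s) (s≤s (+-monoʳ-≤ s (n≤1+n s)))) (trans eq (sym (begin
      (toℕ x + m * suc s + suc i) % n   ≡⟨ cong (_% n) (regroup (toℕ x) m s i) ⟩
      (toℕ x + m * s + i + n) % n       ≡⟨ [m+n]%n≡m%n (toℕ x + m * s + i) n ⟩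
      (toℕ x + m * s + i) % n           ∎)))
    where
    open ≡-Reasoning
    regroup : ∀ a m s i → a + m * suc s + suc i ≡ (a + m * s + i) + suc m
    regroup = solve-∀
  reachable-step {x} {s} {c} (reachable i i≤2s eq) (inj₂ (inj₁ refl)) =
    reachable (suc (suc i)) (s≤s (subst (suc i ≤_) (sym (+-suc s s)) (s≤s i≤2s))) (begin
      toℕ (right c)                            ≡⟨ toℕ-right c ⟩
      suc (toℕ c) % n                          ≡⟨ cong (_% n) (+-comm 1 (toℕ c)) ⟩
      (toℕ c + 1) % n                          ≡⟨ cong (λ z → (z + 1) % n) eq ⟩
      ((toℕ x + m * s + i) % n + 1) % n        ≡⟨ [a%n+b]%n≡[a+b]%n (toℕ x + m * s + i) 1 ⟩
      (toℕ x + m * s + i + 1) % n              ≡⟨ [m+n]%n≡m%n (toℕ x + m * s + i + 1) n ⟨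
      (toℕ x + m * s + i + 1 + n) % n          ≡⟨ cong (_% n) (regroup (toℕ x) m s i) ⟩
      (toℕ x + m * suc s + suc (suc i)) % n    ∎)
    where
    open ≡-Reasoning
    regroup : ∀ a m s i → a + m * s + i + 1 + suc m ≡ a + m * suc s + suc (suc i)
    regroup = solve-∀
  reachable-step {x} {s} {c} (reachable i i≤2s eq) (inj₂ (inj₂ refl)) =
    reachable i (≤-trans i≤2s (≤-trans (n≤1+n _) (s≤s (+-monoʳ-≤ s (n≤1+n s))))) (begin
      toℕ (left c)                             ≡⟨ toℕ-left c ⟩
      (toℕ c + m) % n                          ≡⟨ cong (λ z → (z + m) % n) eq ⟩
      ((toℕ x + m * s + i) % n + m) % n        ≡⟨ [a%n+b]%n≡[a+b]%n (toℕ x + m * s + i) m ⟩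
      (toℕ x + m * s + i + m) % n              ≡⟨ cong (_% n) (regroup (toℕ x) m s i) ⟩
      (toℕ x + m * suc s + i) % n              ∎)
    where
    open ≡-Reasoning
    regroup : ∀ a m s i → a + m * s + i + m ≡ a + m * suc s + i
    regroup = solve-∀

  cop-reachable : ∀ (σ : Strategy) h j → Reachable (lookup (pos σ []) j) (length h) (lookup (pos σ h) j)
  cop-reachable σ []      j = reachable-zero _
  cop-reachable σ (r ∷ h) j = reachable-step (cop-reachable σ h j) (valid σ h r j)

  -- Lifting x and v to z and ρ in ℕ, the hypotheses say v is more than s away from x on both sides.
  reachable-far : ∀ {x s c} → Reachable x s c → ∀ z ρ (v : Fin n) → z % n ≡ toℕ x → ρ % n ≡ toℕ v →
                  z + s < ρ → ρ + s < z + n → c ≢ v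
  reachable-far {x} {s} {c} (reachable i i≤2s eq) z ρ v z≡x ρ≡v z+s<ρ ρ+s<z+n refl =
    %-≢-within-period a b b<a a<b+n a%n≡b%n
    where
    a : ℕ
    a = ρ + s * n
    b : ℕ
    b = z + (m * s + i)
    a%n≡b%n : a % n ≡ b % n
    a%n≡b%n = begin
      a % n                            ≡⟨ [m+kn]%n≡m%n ρ s n ⟩
      ρ % n                            ≡⟨ ρ≡v ⟩
      toℕ c                            ≡⟨ eq ⟩
      (toℕ x + m * s + i) % n          ≡⟨ cong (_% n) (+-assoc (toℕ x) (m * s) i) ⟩
      (toℕ x + (m * s + i)) % n        ≡⟨ cong (λ w → (w + (m * s + i)) % n) (sym z≡x) ⟩
      (z % n + (m * s + i)) % n        ≡⟨ [a%n+b]%n≡[a+b]%n z (m * s + i) ⟩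
      b % n                            ∎
      where open ≡-Reasoning
    b<a : b < a
    b<a with m≤n⇒∃[o]m+o≡n z+s<ρ | m≤n⇒∃[o]m+o≡n i≤2s
    ... | d , refl | d′ , 2s≡i+d′ = ≤-by-difference (d + d′) (begin
      suc (z + s + d) + s * n             ≡⟨ regroup z s d m ⟩
      suc (z + m * s + d + (s + s))       ≡⟨ cong (λ w → suc (z + m * s + d + w)) (sym 2s≡i+d′) ⟩
      suc (z + m * s + d + (i + d′))      ≡⟨ regroup2 z s d m i d′ ⟩
      suc (b + (d + d′))                  ∎)
      where
      open ≡-Reasoning
      regroup : ∀ z s d m → suc (z + s + d) + s * suc m ≡ suc (z + m * s + d + (s + s))
      regroup = solve-∀
      regroup2 : ∀ z s d m i d′ → suc (z + m * s + d + (i + d′)) ≡ suc (z + (m * s + i) + (d + d′))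
      regroup2 = solve-∀
    a<b+n : a < b + n
    a<b+n with m≤n⇒∃[o]m+o≡n ρ+s<z+n
    ... | d , ρ+s+d≡z+n = ≤-by-difference (d + i) (begin
      z + (m * s + i) + suc m             ≡⟨ regroup z m s i ⟩
      (z + n) + (m * s + i)               ≡⟨ cong (_+ (m * s + i)) (sym ρ+s+d≡z+n) ⟩
      suc (ρ + s + d) + (m * s + i)       ≡⟨ regroup2 ρ s d m i ⟩
      suc (ρ + s * n + (d + i))           ∎)
      where
      open ≡-Reasoning
      regroup : ∀ z m s i → z + (m * s + i) + suc m ≡ (z + suc m) + (m * s + i)
      regroup = solve-∀
      regroup2 : ∀ ρ s d m i → suc (ρ + s + d) + (m * s + i) ≡ suc (ρ + s * suc m + (d + i))
      regroup2 = solve-∀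

module RobberWalks (m : ℕ) where

  open CycleArithmetic m

  open Cycle n

  move : Bool → Fin n → Fin n
  move true  = right
  move false = left

  position : Fin n → List Bool → Fin n
  position y []      = y
  position y (b ∷ ω) = move b (position y ω)

  history : Fin n → List Bool → List (Fin n)
  history y []      = []
  history y (b ∷ ω) = position y ω ∷ history y ω

  walk : Fin n → List Bool → List (Fin n)
  walk y ω = position y ω ∷ history y ω

  length-history : ∀ y ω → length (history y ω) ≡ length ω
  length-history y []      = refl
  length-history y (b ∷ ω) = cong suc (length-history y ω)

  extend : List (Fin n) → List (List (Fin n))
  extend []      = []
  extend (r ∷ h) = map (λ r′ → r′ ∷ r ∷ h) (neighbours r)

  walks : ℕ → List (List (Fin n))
  walks zero    = map (λ y → y ∷ []) (allFin n)
  walks (suc t) = concatMap extend (walks t)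

  sumBy-walks : ∀ t (F : List (Fin n) → ℕ) →
                sumBy F (walks t) ≡ sumBy (λ y → sumBy (F ∘ walk y) (bitStrings t)) (allFin n)
  sumBy-walks zero    F =
    trans (sumBy-map F (λ y → y ∷ []) (allFin n)) (sumBy-cong (λ y → sym (+-identityʳ _)) (allFin n))
  sumBy-walks (suc t) F = begin
    sumBy F (concatMap extend (walks t))                               ≡⟨ sumBy-concatMap F extend (walks t) ⟩
    sumBy (sumBy F ∘ extend) (walks t)                                 ≡⟨ sumBy-walks t (sumBy F ∘ extend) ⟩
    sumBy (λ y → sumBy (sumBy F ∘ extend ∘ walk y) (bitStrings t)) (allFin n)
      ≡⟨ sumBy-cong (λ y → sumBy-concatMap (F ∘ walk y) extendBits (bitStrings t)) (allFin n) ⟨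
    sumBy (λ y → sumBy (F ∘ walk y) (bitStrings (suc t))) (allFin n)   ∎
    where open ≡-Reasoning

  alive : Strategy → List (Fin n) → Bool
  alive σ []           = false
  alive σ (y ∷ [])     = not (hit y (pos σ []))
  alive σ (r′ ∷ r ∷ h) = alive σ (r ∷ h) ∧ (not (hit r (pos σ (r ∷ h))) ∧ not (hit r′ (pos σ (r ∷ h))))

  -- `survivors` extends walks by a step function local to its definition; this gives it a name.
  survivors-step : ∀ σ t → Σ (List (Fin n) → List (List (Fin n))) λ step →
                   survivors σ (suc t) ≡ concatMap step (survivors σ t)
  survivors-step σ t = _ , refl

  survivorStep : Strategy → ℕ → List (Fin n) → List (List (Fin n))
  survivorStep σ t = proj₁ (survivors-step σ t)

  alive-extend-dead : ∀ σ r h → alive σ (r ∷ h) ≡ false → ∀ r′ → alive σ (r′ ∷ r ∷ h) ≡ false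
  alive-extend-dead σ r h dead r′ rewrite dead = refl

  alive-extend : ∀ σ r h → alive σ (r ∷ h) ≡ true → ∀ r′ →
                 alive σ (r′ ∷ r ∷ h) ≡ not (hit r (pos σ (r ∷ h))) ∧ not (hit r′ (pos σ (r ∷ h)))
  alive-extend σ r h al r′ rewrite al = refl

  filter-alive-extend-dead : ∀ σ w → alive σ w ≡ false → filterᵇ (alive σ) (extend w) ≡ []
  filter-alive-extend-dead σ []      _    = refl
  filter-alive-extend-dead σ (r ∷ h) dead =
    trans (filterᵇ-map (alive σ) (λ r′ → r′ ∷ r ∷ h) (neighbours r))
          (cong (map _) (filterᵇ-none _ (neighbours r) (alive-extend-dead σ r h dead)))

  filter-alive-extend : ∀ σ t w → alive σ w ≡ true → filterᵇ (alive σ) (extend w) ≡ survivorStep σ t w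
  filter-alive-extend σ t (r ∷ h) al = begin
    filterᵇ (alive σ) (extend (r ∷ h))                ≡⟨ filterᵇ-map (alive σ) (_∷ r ∷ h) (neighbours r) ⟩
    map (_∷ r ∷ h) (filterᵇ (λ r′ → alive σ (r′ ∷ r ∷ h)) (neighbours r))
      ≡⟨ cong (map _) (filterᵇ-cong (alive-extend σ r h al) (neighbours r)) ⟩
    map (_∷ r ∷ h) (filterᵇ (λ r′ → not (hit r c) ∧ not (hit r′ c)) (neighbours r)) ≡⟨ by-capture-of-r ⟩
    survivorStep σ t (r ∷ h)                          ∎
    where
    open ≡-Reasoning
    c : Cops
    c = pos σ (r ∷ h)
    by-capture-of-r : map (_∷ r ∷ h) (filterᵇ (λ r′ → not (hit r c) ∧ not (hit r′ c)) (neighbours r)) ≡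
                      survivorStep σ t (r ∷ h)
    by-capture-of-r with hit r c
    ... | true  = cong (map (_∷ r ∷ h)) (filterᵇ-none (λ _ → false) (neighbours r) (λ _ → refl))
    ... | false = refl

  concatMap-step-filter-alive : ∀ σ t L →
    concatMap (survivorStep σ t) (filterᵇ (alive σ) L) ≡ filterᵇ (alive σ) (concatMap extend L)
  concatMap-step-filter-alive σ t []      = refl
  concatMap-step-filter-alive σ t (w ∷ L) with alive σ w in al
  ... | true  = trans (cong₂ _++_ (sym (filter-alive-extend σ t w al)) (concatMap-step-filter-alive σ t L))
                      (sym (filter-++ (T? ∘ alive σ) (extend w) (concatMap extend L)))
  ... | false = trans (cong (_++_ []) (concatMap-step-filter-alive σ t L))
                      (trans (cong (_++ _) (sym (filter-alive-extend-dead σ w al)))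
                             (sym (filter-++ (T? ∘ alive σ) (extend w) (concatMap extend L))))

  survivors≡filter-alive : ∀ σ t → survivors σ t ≡ filterᵇ (alive σ) (walks t)
  survivors≡filter-alive σ zero    = sym (filterᵇ-map (alive σ) (λ y → y ∷ []) (allFin n))
  survivors≡filter-alive σ (suc t) = begin
    survivors σ (suc t)                                        ≡⟨⟩
    concatMap (survivorStep σ t) (survivors σ t)               ≡⟨ cong (concatMap _) (survivors≡filter-alive σ t) ⟩
    concatMap (survivorStep σ t) (filterᵇ (alive σ) (walks t)) ≡⟨ concatMap-step-filter-alive σ t (walks t) ⟩
    filterᵇ (alive σ) (walks (suc t))                          ∎
    where open ≡-Reasoning

  length-survivors : ∀ σ t → length (survivors σ t) ≡
    sumBy (λ ω → sumBy (λ y → indicator (alive σ (walk y ω))) (allFin n)) (bitStrings t)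
  length-survivors σ t = begin
    length (survivors σ t)                                  ≡⟨ cong length (survivors≡filter-alive σ t) ⟩
    length (filterᵇ (alive σ) (walks t))                    ≡⟨ sumBy-filterᵇ (alive σ) (walks t) ⟩
    sumBy (indicator ∘ alive σ) (walks t)                   ≡⟨ sumBy-walks t (indicator ∘ alive σ) ⟩
    sumBy (λ y → sumBy (λ ω → indicator (alive σ (walk y ω))) (bitStrings t)) (allFin n)
      ≡⟨ sumBy-comm (λ y ω → indicator (alive σ (walk y ω))) (allFin n) (bitStrings t) ⟩
    sumBy (λ ω → sumBy (λ y → indicator (alive σ (walk y ω))) (allFin n)) (bitStrings t) ∎
    where open ≡-Reasoning

  toℕ-mod-inverse : ∀ v → toℕ v mod n ≡ v
  toℕ-mod-inverse v = toℕ-injective (trans (toℕ-mod (toℕ v)) (toℕ%n v))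

  Σ<-rotate-mod : ∀ (G : Fin n → ℕ) c → Σ< n (λ i → G ((c + i) mod n)) ≡ Σ< n (λ i → G (i mod n))
  Σ<-rotate-mod G zero    = refl
  Σ<-rotate-mod G (suc c) = begin
    Σ< n (λ i → G ((suc c + i) mod n)) ≡⟨ Σ<-cong n (λ i _ → cong (λ k → G (k mod n)) (sym (+-suc c i))) ⟩
    Σ< n (λ i → G ((c + suc i) mod n)) ≡⟨ Σ<-rotate n (λ i → G ((c + i) mod n)) (cong G c+n≡c+0) ⟩
    Σ< n (λ i → G ((c + i) mod n))     ≡⟨ Σ<-rotate-mod G c ⟩
    Σ< n (λ i → G (i mod n))           ∎
    where
    open ≡-Reasoning
    c+n≡c+0 : (c + n) mod n ≡ (c + 0) mod n
    c+n≡c+0 = mod-cong (c + n) (c + 0) (trans ([m+n]%n≡m%n c n) (cong (_% n) (sym (+-identityʳ c))))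

  sumBy-allFin-rotate : ∀ c (F : Fin n → ℕ) →
                        sumBy (λ v → F ((c + toℕ v) mod n)) (allFin n) ≡ sumBy F (allFin n)
  sumBy-allFin-rotate c F = begin
    sumBy (λ v → F ((c + toℕ v) mod n)) (allFin n) ≡⟨ sumBy-allFin n (λ i → F ((c + i) mod n)) ⟩
    Σ< n (λ i → F ((c + i) mod n))                 ≡⟨ Σ<-rotate-mod F c ⟩
    Σ< n (λ i → F (i mod n))                       ≡⟨ sumBy-allFin n (λ i → F (i mod n)) ⟨
    sumBy (λ v → F (toℕ v mod n)) (allFin n)       ≡⟨ sumBy-cong (λ v → cong F (toℕ-mod-inverse v)) (allFin n) ⟩
    sumBy F (allFin n)                             ∎
    where open ≡-Reasoning

  sumBy-position : ∀ ω (F : Fin n → ℕ) → sumBy (λ y → F (position y ω)) (allFin n) ≡ sumBy F (allFin n)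
  sumBy-position []          F = refl
  sumBy-position (true ∷ ω)  F = trans (sumBy-position ω (F ∘ right)) (sumBy-allFin-rotate 1 F)
  sumBy-position (false ∷ ω) F =
    trans (sumBy-position ω (F ∘ left))
          (trans (sumBy-cong (λ v → cong (λ k → F (k mod n)) (+-comm (toℕ v) m)) (allFin n)) (sumBy-allFin-rotate m F))

module TailSums (m : ℕ) where

  open CycleArithmetic m using (n)

  open Cycle n

  pred2^ : ℕ → ℕ
  pred2^ t = pred (2 ^ t)

  suc-pred2^ : ∀ t → suc (pred2^ t) ≡ 2 ^ t
  suc-pred2^ t = suc-pred (2 ^ t) {{m^n≢0 2 t}}

  toℚᵘ-halfPow : ∀ t → toℚᵘ (halfPow t) ℚᵘ.≃ fracᵘ 1 (pred2^ t)
  toℚᵘ-halfPow zero    = ℚᵘ.≃-refl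
  toℚᵘ-halfPow (suc t) = begin
    toℚᵘ (½ ℚ.* halfPow t)                         ≈⟨ ℚ.toℚᵘ-homo-* ½ (halfPow t) ⟩
    toℚᵘ ½ ℚᵘ.* toℚᵘ (halfPow t)                   ≈⟨ ℚᵘ.*-congˡ {toℚᵘ ½} (toℚᵘ-halfPow t) ⟩
    fracᵘ 1 1 ℚᵘ.* fracᵘ 1 (pred2^ t)              ≡⟨ fracᵘ-* 1 1 1 (pred2^ t) ⟩
    fracᵘ 1 (pred2^ t + 1 * suc (pred2^ t))        ≈⟨ fracᵘ-cong _ _ _ _ denominators ⟩
    fracᵘ 1 (pred2^ (suc t))                       ∎
    where
    open ℚᵘ.≃-Reasoning
    denominators : 1 * suc (pred2^ (suc t)) ≡ 1 * 1 * suc (pred2^ t + 1 * suc (pred2^ t))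
    denominators = trans (cong (1 *_) (suc-pred2^ (suc t)))
                         (trans (double (2 ^ t)) (cong (λ z → 1 * 1 * (z + 1 * z)) (sym (suc-pred2^ t))))
      where
      double : ∀ x → 1 * (2 * x) ≡ 1 * 1 * (x + 1 * x)
      double = solve-∀

  -- n 2 ^ t - 1, the shifted denominator of tailProb σ t
  denominator : ℕ → ℕ
  denominator t = pred2^ t + m * suc (pred2^ t)

  suc-denominator : ∀ t → suc (denominator t) ≡ n * 2 ^ t
  suc-denominator t = trans (regroup m (pred2^ t)) (cong (n *_) (suc-pred2^ t))
    where
    regroup : ∀ m p → suc (p + m * suc p) ≡ suc m * suc p
    regroup = solve-∀

  toℚᵘ-tailProb : ∀ σ t → toℚᵘ (tailProb σ t) ℚᵘ.≃ fracᵘ (length (survivors σ t) * 1) (denominator t)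
  toℚᵘ-tailProb σ t = ℚᵘ.≃-trans (ℚ.toℚᵘ-homo-* ((ℤ.+ length (survivors σ t)) ℚ./ n) (halfPow t))
    (ℚᵘ.≃-trans (ℚᵘ.*-cong (toℚᵘ-/ (length (survivors σ t)) m) (toℚᵘ-halfPow t))
                (ℚᵘ.≃-reflexive (fracᵘ-* (length (survivors σ t)) m 1 (pred2^ t))))

  partialE-≥ : ∀ σ (c : ℕ → ℕ) → (∀ t → 2 ^ t * c t ≤ length (survivors σ t)) →
               ∀ N → fracᵘ (Σ< N c) m ℚᵘ.≤ toℚᵘ (partialE σ N)
  partialE-≥ σ c c≤ zero    = fracᵘ-mono 0 m 0 0 z≤n
  partialE-≥ σ c c≤ (suc N) = begin
    fracᵘ (Σ< N c + c N) m                         ≃⟨ fracᵘ-+-sameDenominator (Σ< N c) (c N) m ⟨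
    fracᵘ (Σ< N c) m ℚᵘ.+ fracᵘ (c N) m            ≤⟨ ℚᵘ.+-mono-≤ (partialE-≥ σ c c≤ N) term ⟩
    toℚᵘ (partialE σ N) ℚᵘ.+ toℚᵘ (tailProb σ N)   ≃⟨ ℚ.toℚᵘ-homo-+ (partialE σ N) (tailProb σ N) ⟨
    toℚᵘ (partialE σ (suc N))                      ∎
    where
    open ℚᵘ.≤-Reasoning
    len : ℕ
    len = length (survivors σ N)
    term : fracᵘ (c N) m ℚᵘ.≤ toℚᵘ (tailProb σ N)
    term = ℚᵘ.≤-trans (fracᵘ-mono (c N) m (len * 1) (denominator N) cross-multiplied)
                      (ℚᵘ.≤-reflexive (ℚᵘ.≃-sym (toℚᵘ-tailProb σ N)))
      where
      cross-multiplied : c N * suc (denominator N) ≤ len * 1 * n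
      cross-multiplied = ≤-trans (≤-reflexive (trans (cong (c N *_) (suc-denominator N)) (regroup (c N) n (2 ^ N))))
                                 (≤-trans (*-monoˡ-≤ n (c≤ N)) (≤-reflexive (cong (_* n) (sym (*-identityʳ len)))))
        where
        regroup : ∀ a b c → a * (b * c) ≡ (c * a) * b
        regroup = solve-∀

  partialE-≤ : ∀ σ (u : ℕ → ℕ) → (∀ t → length (survivors σ t) ≤ 2 ^ t * u t) →
               ∀ N → toℚᵘ (partialE σ N) ℚᵘ.≤ fracᵘ (Σ< N u) m
  partialE-≤ σ u ≤u zero    = fracᵘ-mono 0 0 0 m z≤n
  partialE-≤ σ u ≤u (suc N) = begin
    toℚᵘ (partialE σ (suc N))                      ≃⟨ ℚ.toℚᵘ-homo-+ (partialE σ N) (tailProb σ N) ⟩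
    toℚᵘ (partialE σ N) ℚᵘ.+ toℚᵘ (tailProb σ N)   ≤⟨ ℚᵘ.+-mono-≤ (partialE-≤ σ u ≤u N) term ⟩
    fracᵘ (Σ< N u) m ℚᵘ.+ fracᵘ (u N) m            ≃⟨ fracᵘ-+-sameDenominator (Σ< N u) (u N) m ⟩
    fracᵘ (Σ< N u + u N) m                         ∎
    where
    open ℚᵘ.≤-Reasoning
    len : ℕ
    len = length (survivors σ N)
    term : toℚᵘ (tailProb σ N) ℚᵘ.≤ fracᵘ (u N) m
    term = ℚᵘ.≤-trans (ℚᵘ.≤-reflexive (toℚᵘ-tailProb σ N))
                      (fracᵘ-mono (len * 1) (denominator N) (u N) m cross-multiplied)
      where
      cross-multiplied : len * 1 * n ≤ u N * suc (denominator N)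
      cross-multiplied = ≤-trans (≤-reflexive (cong (_* n) (*-identityʳ len))) (≤-trans (*-monoˡ-≤ n (≤u N))
        (≤-reflexive (sym (trans (cong (u N *_) (suc-denominator N)) (regroup (u N) n (2 ^ N))))))
        where
        regroup : ∀ a b c → a * (b * c) ≡ (c * a) * b
        regroup = solve-∀

module LowerBound (m : ℕ) where

  open CycleArithmetic m
  open CopMoves m
  open RobberWalks m

  open Cycle n

  toℕ-unmove : ∀ b v ρ → toℕ (move b v) ≡ ρ % n → 1 ≤ ρ → toℕ v ≡ unmove b ρ % n
  toℕ-unmove true v (suc ρ) right≡ _ = begin
    toℕ v                          ≡⟨ toℕ%n v ⟨
    toℕ v % n                      ≡⟨ [m+n]%n≡m%n (toℕ v) n ⟨
    (toℕ v + n) % n                ≡⟨ cong (_% n) (+-suc (toℕ v) m) ⟩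
    (suc (toℕ v) + m) % n          ≡⟨ [a%n+b]%n≡[a+b]%n (suc (toℕ v)) m ⟨
    (suc (toℕ v) % n + m) % n      ≡⟨ cong (λ z → (z + m) % n) (trans (sym (toℕ-right v)) right≡) ⟩
    (suc ρ % n + m) % n            ≡⟨ [a%n+b]%n≡[a+b]%n (suc ρ) m ⟩
    (suc ρ + m) % n                ≡⟨ cong (_% n) (sym (+-suc ρ m)) ⟩
    (ρ + n) % n                    ≡⟨ [m+n]%n≡m%n ρ n ⟩
    ρ % n                          ∎
    where open ≡-Reasoning
  toℕ-unmove false v ρ left≡ _ = begin
    toℕ v                          ≡⟨ toℕ%n v ⟨
    toℕ v % n                      ≡⟨ [m+n]%n≡m%n (toℕ v) n ⟨
    (toℕ v + n) % n                ≡⟨ cong (_% n) (trans (+-suc (toℕ v) m) (+-comm 1 (toℕ v + m))) ⟩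
    (toℕ v + m + 1) % n            ≡⟨ [a%n+b]%n≡[a+b]%n (toℕ v + m) 1 ⟨
    ((toℕ v + m) % n + 1) % n      ≡⟨ cong (λ z → (z + 1) % n) (trans (sym (toℕ-left v)) left≡) ⟩
    (ρ % n + 1) % n                ≡⟨ [a%n+b]%n≡[a+b]%n ρ 1 ⟩
    (ρ + 1) % n                    ≡⟨ cong (_% n) (+-comm ρ 1) ⟩
    suc ρ % n                      ∎
    where open ≡-Reasoning

  -- Every point of depth s in the arc (L , R) of ℕ lies, up to a multiple of n, strictly between
  -- a lift z of a cop's start and z + n, more than s away from both.
  CopFreeArc : Strategy → ℕ → ℕ → Set
  CopFreeArc σ L R = ∀ j s ρ → L + s < ρ → ρ + s < R →
    Σ ℕ λ z → Σ ℕ λ ρ₁ → z % n ≡ toℕ (lookup (pos σ []) j) × ρ₁ % n ≡ ρ % n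
                       × z + s < ρ₁ × ρ₁ + s < z + n

  not-hit-in-arc : ∀ σ L R → CopFreeArc σ L R → ∀ h s → length h ≡ s → ∀ ρ (v : Fin n) → toℕ v ≡ ρ % n →
                   L + s < ρ → ρ + s < R → hit v (pos σ h) ≡ false
  not-hit-in-arc σ L R free h s refl ρ v v≡ρ L+s<ρ ρ+s<R = hit-false v (pos σ h) far
    where
    far : ∀ j → lookup (pos σ h) j ≢ v
    far j with free j s ρ L+s<ρ ρ+s<R
    ... | z , ρ₁ , z≡x , ρ₁≡ρ , z+s<ρ₁ , ρ₁+s<z+n =
      reachable-far (cop-reachable σ h j) z ρ₁ v z≡x (trans ρ₁≡ρ (sym v≡ρ)) z+s<ρ₁ ρ₁+s<z+n

  alive-in-arc : ∀ σ L R → CopFreeArc σ L R → ∀ ω y ρ → toℕ (position y ω) ≡ ρ % n →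
                 T (inArc L R (suc (length ω)) ρ) → alive σ (walk y ω) ≡ true
  alive-in-arc σ L R free []      y ρ y≡ρ deep with inWindow⇒ (L + 0) 0 R ρ (inArc-weaken L R 0 ρ deep)
  ... | L<ρ , ρ<R = cong not (not-hit-in-arc σ L R free [] 0 refl ρ y y≡ρ L<ρ ρ<R)
  alive-in-arc σ L R free (b ∷ ω) y ρ cur≡ρ deep =
    cong₂ _∧_ (alive-in-arc σ L R free ω y ρ′ prev≡ρ′ deep′)
              (cong₂ (λ u w → not u ∧ not w) (safe prev≡ρ′ deep′) (safe cur≡ρ (inArc-weaken L R s ρ deep)))
    where
    s : ℕ
    s = suc (length ω)
    ρ′ : ℕ
    ρ′ = unmove b ρ
    deep′ : T (inArc L R s ρ′)
    deep′ = inArc-unmove L R s ρ deep b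
    1≤ρ : 1 ≤ ρ
    1≤ρ = ≤-trans (s≤s z≤n) (≤-trans (m≤n+m (suc s) L) (<⇒≤ (proj₁ (inWindow⇒ (L + suc s) (suc s) R ρ deep))))
    prev≡ρ′ : toℕ (position y ω) ≡ ρ′ % n
    prev≡ρ′ = toℕ-unmove b (position y ω) ρ cur≡ρ 1≤ρ
    safe : ∀ {v ρ} → toℕ v ≡ ρ % n → T (inArc L R s ρ) → hit v (pos σ (walk y ω)) ≡ false
    safe {v} {ρ} v≡ρ q with inWindow⇒ (L + s) s R ρ q
    ... | L+s<ρ , ρ+s<R = not-hit-in-arc σ L R free (walk y ω) s (cong suc (length-history y ω)) ρ v v≡ρ L+s<ρ ρ+s<R

  module Arcs (σ : Strategy) where

    a : ℕ
    a = toℕ (lookup (pos σ []) fzero)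

    lift : ℕ → ℕ
    lift j with a ≤? j
    ... | yes _ = j
    ... | no  _ = j + n

    lift-mod : ∀ j → j < n → lift j % n ≡ j
    lift-mod j j<n with a ≤? j
    ... | yes _ = m<n⇒m%n≡m j<n
    ... | no  _ = trans ([m+n]%n≡m%n j n) (m<n⇒m%n≡m j<n)

    a≤lift : ∀ j → a ≤ lift j
    a≤lift j with a ≤? j
    ... | yes a≤j = a≤j
    ... | no  _   = ≤-trans (<⇒≤ (toℕ<n (lookup (pos σ []) fzero))) (m≤n+m n j)

    lift<a+n : ∀ j → j < n → lift j < a + n
    lift<a+n j j<n with a ≤? j
    ... | yes _   = ≤-trans j<n (m≤n+m n a)
    ... | no  a≰j = subst₂ _<_ (+-comm n j) (+-comm n a) (+-monoʳ-< n (≰⇒> a≰j))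

    lift-shift : ∀ i → i < n → lift (toℕ ((a + i) mod n)) ≡ a + i
    lift-shift i i<n = %-injective-window (a≤lift j) (lift<a+n j j<n) (m≤m+n a i) (+-monoʳ-< a i<n)
                         (trans (lift-mod j j<n) (toℕ-mod (a + i)))
      where
      j : ℕ
      j = toℕ ((a + i) mod n)
      j<n : j < n
      j<n = toℕ<n ((a + i) mod n)

    b : ℕ
    b = lift (toℕ (lookup (pos σ []) (fsuc fzero)))

    a≤b : a ≤ b
    a≤b = a≤lift _

    b<a+n : b < a + n
    b<a+n = lift<a+n _ (toℕ<n _)

    copFree-ab : CopFreeArc σ a b
    copFree-ab fzero        s ρ a+s<ρ ρ+s<b =
      a , ρ , toℕ%n _ , refl , a+s<ρ , <-trans ρ+s<b b<a+n
    copFree-ab (fsuc fzero) s ρ a+s<ρ ρ+s<b =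
      b , ρ + n , lift-mod _ (toℕ<n _) , [m+n]%n≡m%n ρ n ,
      ≤-<-trans (<⇒≤ (+-monoˡ-< s b<a+n)) (subst (_< ρ + n) (xy∙z≈xz∙y a s n) (+-monoˡ-< n a+s<ρ)) ,
      subst (_< b + n) (xy∙z≈xz∙y ρ s n) (+-monoˡ-< n ρ+s<b)

    copFree-ba : CopFreeArc σ b (a + n)
    copFree-ba fzero        s ρ b+s<ρ ρ+s<a+n =
      a , ρ , toℕ%n _ , refl , ≤-<-trans (+-monoˡ-≤ s a≤b) b+s<ρ , ρ+s<a+n
    copFree-ba (fsuc fzero) s ρ b+s<ρ ρ+s<a+n =
      b , ρ , lift-mod _ (toℕ<n _) , refl , b+s<ρ , <-≤-trans ρ+s<a+n (+-monoˡ-≤ n a≤b)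

    deep : ℕ → Fin n → Bool
    deep t v = inArc a b (suc t) (lift (toℕ v)) ∨ inArc b (a + n) (suc t) (lift (toℕ v))

    deep⇒alive : ∀ ω y → indicator (deep (length ω) (position y ω)) ≤ indicator (alive σ (walk y ω))
    deep⇒alive ω y = indicator-mono λ p → subst T (sym (either (Equivalence.to T-∨ p))) tt
      where
      ρ : ℕ
      ρ = lift (toℕ (position y ω))
      v≡ρ : toℕ (position y ω) ≡ ρ % n
      v≡ρ = sym (lift-mod _ (toℕ<n _))
      either : T (inArc a b (suc (length ω)) ρ) ⊎ T (inArc b (a + n) (suc (length ω)) ρ) → alive σ (walk y ω) ≡ true
      either (inj₁ p) = alive-in-arc σ a b copFree-ab ω y ρ v≡ρ p
      either (inj₂ p) = alive-in-arc σ b (a + n) copFree-ba ω y ρ v≡ρ p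

    count-deep : ∀ ω → Σ< n (λ i → indicator (inArc a b (suc (length ω)) (a + i)))
                       + Σ< n (λ i → indicator (inArc b (a + n) (suc (length ω)) (a + i)))
                       ≤ sumBy (λ y → indicator (alive σ (walk y ω))) (allFin n)
    count-deep ω = begin
      Σ< n (λ i → indicator (A (a + i))) + Σ< n (λ i → indicator (B (a + i)))
        ≡⟨ Σ<-+ n (λ i → indicator (A (a + i))) (λ i → indicator (B (a + i))) ⟨
      Σ< n (λ i → indicator (A (a + i)) + indicator (B (a + i)))      ≡⟨ Σ<-cong n split ⟩
      Σ< n (λ i → indicator (deep t ((a + i) mod n)))                 ≡⟨ sumBy-allFin n _ ⟨
      sumBy (λ v → indicator (deep t ((a + toℕ v) mod n))) (allFin n) ≡⟨ sumBy-allFin-rotate a (indicator ∘ deep t) ⟩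
      sumBy (indicator ∘ deep t) (allFin n)                           ≡⟨ sumBy-position ω (indicator ∘ deep t) ⟨
      sumBy (λ y → indicator (deep t (position y ω))) (allFin n)      ≤⟨ sumBy-mono (deep⇒alive ω) (allFin n) ⟩
      sumBy (λ y → indicator (alive σ (walk y ω))) (allFin n)         ∎
      where
      open ≤-Reasoning
      t : ℕ
      t = length ω
      A : ℕ → Bool
      A = inArc a b (suc t)
      B : ℕ → Bool
      B = inArc b (a + n) (suc t)
      split : ∀ i → i < n → indicator (A (a + i)) + indicator (B (a + i)) ≡ indicator (deep t ((a + i) mod n))
      split i i<n = trans (sym (indicator-∨ _ _ (inArc-disjoint a b (a + n) (suc t) (a + i))))
                          (cong (λ z → indicator (A z ∨ B z)) (sym (lift-shift i i<n)))

    survivalCount : ℕ → ℕ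
    survivalCount t = (b ∸ a ∸ 3 ∸ (t + t)) + (a + n ∸ b ∸ 3 ∸ (t + t))

    survivors-≥ : ∀ t → 2 ^ t * survivalCount t ≤ length (survivors σ t)
    survivors-≥ t = ≤-trans (sumBy-bitStrings-≥ t _ survivalCount per-walk) (≤-reflexive (sym (length-survivors σ t)))
      where
      depth : ∀ R L t → R ∸ L ∸ 3 ∸ (t + t) ≡ R ∸ (L + suc t + suc t + 1)
      depth R L t = trans (∸-+-assoc (R ∸ L) 3 (t + t)) (trans (∸-+-assoc R L (3 + (t + t))) (cong (R ∸_) (regroup L t)))
        where
        regroup : ∀ L t → L + (3 + (t + t)) ≡ L + suc t + suc t + 1
        regroup = solve-∀
      per-walk : ∀ ω → survivalCount (length ω) ≤ sumBy (λ y → indicator (alive σ (walk y ω))) (allFin n)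
      per-walk ω = ≤-trans
        (+-mono-≤ (≤-trans (≤-reflexive (depth b a (length ω))) (count-inArc n a (suc (length ω)) a b ≤-refl (<⇒≤ b<a+n)))
                  (≤-trans (≤-reflexive (depth (a + n) b (length ω))) (count-inArc n a (suc (length ω)) b (a + n) a≤b ≤-refl)))
        (count-deep ω)

    square≤survivalSum : n * n ≤ 8 * Σ< n survivalCount + 12 * n
    square≤survivalSum = subst (λ k → k * k ≤ 8 * Σ< n survivalCount + 12 * k) x+y≡n
      (subst (λ S → (x + y) * (x + y) ≤ 8 * S + 12 * (x + y)) (sym (Σ<-+ n _ _))
        (staircase-pair-lower x y n x≤n y≤n))
      where
      x : ℕ
      x = b ∸ a
      y : ℕ
      y = a + n ∸ b
      x+y≡n : x + y ≡ n
      x+y≡n = begin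
        b ∸ a + (a + n ∸ b)   ≡⟨ +-comm (b ∸ a) (a + n ∸ b) ⟩
        a + n ∸ b + (b ∸ a)   ≡⟨ +-∸-assoc (a + n ∸ b) a≤b ⟨
        a + n ∸ b + b ∸ a     ≡⟨ cong (_∸ a) (m∸n+n≡m (<⇒≤ b<a+n)) ⟩
        a + n ∸ a             ≡⟨ m+n∸m≡n a n ⟩
        n                     ∎
        where open ≡-Reasoning
      x≤n : x ≤ n
      x≤n = ≤-trans (∸-monoˡ-≤ a (<⇒≤ b<a+n)) (≤-reflexive (m+n∸m≡n a n))
      y≤n : y ≤ n
      y≤n = ≤-trans (∸-monoʳ-≤ (a + n) a≤b) (≤-reflexive (m+n∸m≡n a n))

module UpperBound (m : ℕ) where

  open CycleArithmetic m
  open CopMoves m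
  open RobberWalks m

  open Cycle n

  -- If the robber starts in [L , R) while one cop sweeps up from L and another down from R,
  -- a surviving robber stays strictly between them.
  module SweptArc (σ : Strategy) (y : Fin n) (L R : ℕ) (R≤n : R ≤ n) (jL jR : Fin 2)
                  (L≤y : L ≤ toℕ y) (y<R : toℕ y < R) (jL-start : toℕ (lookup (pos σ []) jL) ≡ L)
                  (jL-at : ∀ ω → L + suc (length ω) + suc (length ω) ≤ R →
                           toℕ (lookup (pos σ (walk y ω)) jL) ≡ L + suc (length ω))
                  (jR-at : ∀ ω → L + suc (length ω) + suc (length ω) ≤ R →
                           toℕ (lookup (pos σ (walk y ω)) jR) ≡ R ∸ suc (length ω)) where

    avoids : ∀ v c j → hit v c ≡ false → toℕ (lookup c j) ≢ toℕ v
    avoids v c j miss eq = hit-false⇒≢ v c miss j (toℕ-injective eq)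

    split-alive : ∀ b ω → alive σ (walk y (b ∷ ω)) ≡ true →
                  alive σ (walk y ω) ≡ true × hit (position y ω) (pos σ (walk y ω)) ≡ false
                  × hit (position y (b ∷ ω)) (pos σ (walk y ω)) ≡ false
    split-alive b ω al
      with alive σ (walk y ω) | hit (position y ω) (pos σ (walk y ω)) | hit (position y (b ∷ ω)) (pos σ (walk y ω))
    split-alive b ω al | true  | false | false = refl , refl , refl
    split-alive b ω () | true  | false | true
    split-alive b ω () | true  | true  | _
    split-alive b ω () | false | _     | _

    Deep : ℕ → ℕ → Set
    Deep s ρ = L + s < ρ × ρ + s < R

    toℕ-position-right : ∀ ω → toℕ (position y ω) + suc (length ω) < R →
                         toℕ (position y (true ∷ ω)) ≡ suc (toℕ (position y ω))
    toℕ-position-right ω ρ′+s<R = toℕ-right-< (position y ω)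
      (≤-<-trans (m≤m+n _ (length ω)) (subst (_≤ n) (+-suc _ (length ω)) (≤-trans ρ′+s<R R≤n)))

    mutual
      invariant : ∀ ω → alive σ (walk y ω) ≡ true → Deep (length ω) (toℕ (position y ω))
      invariant [] al =
        ≤∧≢⇒< (subst (_≤ toℕ y) (sym (+-identityʳ L)) L≤y) L≢y , subst (_< R) (sym (+-identityʳ _)) y<R
        where
        L≢y : L + 0 ≢ toℕ y
        L≢y eq = avoids y (pos σ []) jL (not-injective al) (trans jL-start (trans (sym (+-identityʳ L)) eq))
      invariant (b ∷ ω) al with split-alive b ω al | invariant-prev b ω al
      ... | _ , _ , miss | L+s<ρ′ , ρ′+s<R = step b miss
        where
        s : ℕ
        s = suc (length ω)
        ρ′ : ℕ
        ρ′ = toℕ (position y ω)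
        fits : L + s + s ≤ R
        fits = <⇒≤ (<-trans (+-monoˡ-< s L+s<ρ′) ρ′+s<R)
        step : ∀ b → hit (position y (b ∷ ω)) (pos σ (walk y ω)) ≡ false → Deep s (toℕ (position y (b ∷ ω)))
        step true  miss = subst (Deep s) (sym cur≡)
          (<-trans L+s<ρ′ (n<1+n ρ′) ,
           ≤∧≢⇒< ρ′+s<R (λ eq → avoids (position y (true ∷ ω)) (pos σ (walk y ω)) jR miss
             (trans (jR-at ω fits) (trans (cong (_∸ s) (sym eq)) (trans (m+n∸n≡m (suc ρ′) s) (sym cur≡))))))
          where
          cur≡ : toℕ (position y (true ∷ ω)) ≡ suc ρ′
          cur≡ = toℕ-position-right ω ρ′+s<R
        step false miss = subst (Deep s) (sym cur≡)
          (≤∧≢⇒< (∸-monoˡ-≤ 1 L+s<ρ′) (λ eq → avoids (position y (false ∷ ω)) (pos σ (walk y ω)) jL miss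
             (trans (jL-at ω fits) (trans eq (sym cur≡)))) ,
           ≤-<-trans (+-monoˡ-≤ s (m∸n≤m ρ′ 1)) ρ′+s<R)
          where
          cur≡ : toℕ (position y (false ∷ ω)) ≡ ρ′ ∸ 1
          cur≡ = toℕ-left-> (position y ω) (≤-<-trans z≤n L+s<ρ′)

      invariant-prev : ∀ b ω → alive σ (walk y (b ∷ ω)) ≡ true → Deep (suc (length ω)) (toℕ (position y ω))
      invariant-prev b ω al with split-alive b ω al
      ... | alive-ω , miss , _ with invariant ω alive-ω
      ... | L+l<ρ′ , ρ′+l<R =
        ≤∧≢⇒< L+s≤ρ′ (λ eq → avoids (position y ω) (pos σ (walk y ω)) jL miss (trans (jL-at ω fits) eq)) ,
        ≤∧≢⇒< ρ′+s≤R (λ eq → avoids (position y ω) (pos σ (walk y ω)) jR miss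
          (trans (jR-at ω fits) (trans (cong (_∸ s) (sym eq)) (m+n∸n≡m ρ′ s))))
        where
        s : ℕ
        s = suc (length ω)
        ρ′ : ℕ
        ρ′ = toℕ (position y ω)
        L+s≤ρ′ : L + s ≤ ρ′
        L+s≤ρ′ = subst (_≤ ρ′) (sym (+-suc L (length ω))) L+l<ρ′
        ρ′+s≤R : ρ′ + s ≤ R
        ρ′+s≤R = subst (_≤ R) (sym (+-suc ρ′ (length ω))) ρ′+l<R
        fits : L + s + s ≤ R
        fits = ≤-trans (+-monoˡ-≤ s L+s≤ρ′) ρ′+s≤R

    in-window : ∀ ω → alive σ (walk y ω) ≡ true → T (window L R ω (toℕ (position y ω)))
    in-window [] al with invariant [] al
    ... | L<y , y<R = ⇒inWindow L 0 R (toℕ y) (subst (_< toℕ y) (+-identityʳ L) L<y) y<R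
    in-window (true ∷ ω) al with invariant (true ∷ ω) al | invariant-prev true ω al
    ... | _ , ρ+s<R | L+s<ρ′ , ρ′+s<R =
      ⇒inWindow (L + suc s) s R ρ (subst₂ _<_ (sym (+-suc L s)) (sym cur≡) (s≤s L+s<ρ′)) ρ+s<R
      where
      s : ℕ
      s = suc (length ω)
      ρ′ : ℕ
      ρ′ = toℕ (position y ω)
      ρ : ℕ
      ρ = toℕ (position y (true ∷ ω))
      cur≡ : ρ ≡ suc ρ′
      cur≡ = toℕ-position-right ω ρ′+s<R
    in-window (false ∷ ω) al with invariant (false ∷ ω) al | invariant-prev false ω al
    ... | L+s<ρ , _ | L+s<ρ′ , ρ′+s<R =
      ⇒inWindow (L + s) (suc s) R ρ L+s<ρ (subst (_< R) (sym ρ+1+s≡ρ′+s) ρ′+s<R)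
      where
      s : ℕ
      s = suc (length ω)
      ρ′ : ℕ
      ρ′ = toℕ (position y ω)
      ρ : ℕ
      ρ = toℕ (position y (false ∷ ω))
      1≤ρ′ : 1 ≤ ρ′
      1≤ρ′ = ≤-<-trans z≤n L+s<ρ′
      ρ+1+s≡ρ′+s : ρ + suc s ≡ ρ′ + s
      ρ+1+s≡ρ′+s = trans (cong (_+ suc s) (toℕ-left-> (position y ω) 1≤ρ′))
                         (trans (+-suc (ρ′ ∸ 1) s) (cong (_+ s) (trans (+-comm 1 (ρ′ ∸ 1)) (m∸n+n≡m 1≤ρ′))))

  module Sweep (p : ℕ) (p<n : p < n) where

    pivot : Fin n
    pivot = fromℕ< p<n

    rightⁱ leftⁱ : ℕ → Fin n → Fin n
    rightⁱ s x = fold x right s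
    leftⁱ  s x = fold x left s

    toℕ-rightⁱ : ∀ s x → toℕ x + s < n → toℕ (rightⁱ s x) ≡ toℕ x + s
    toℕ-rightⁱ zero    x _     = sym (+-identityʳ (toℕ x))
    toℕ-rightⁱ (suc s) x x+s<n = begin
      toℕ (right (rightⁱ s x)) ≡⟨ toℕ-right-< (rightⁱ s x) (subst (_< n) (trans (+-suc _ s) (cong suc (sym IH))) x+s<n) ⟩
      suc (toℕ (rightⁱ s x))   ≡⟨ cong suc IH ⟩
      suc (toℕ x + s)          ≡⟨ +-suc (toℕ x) s ⟨
      toℕ x + suc s            ∎
      where
      open ≡-Reasoning
      IH : toℕ (rightⁱ s x) ≡ toℕ x + s
      IH = toℕ-rightⁱ s x (<-trans (+-monoʳ-< (toℕ x) (n<1+n s)) x+s<n)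

    toℕ-leftⁱ : ∀ s x → s ≤ toℕ x → toℕ (leftⁱ s x) ≡ toℕ x ∸ s
    toℕ-leftⁱ zero    x _   = refl
    toℕ-leftⁱ (suc s) x s<x = begin
      toℕ (left (leftⁱ s x)) ≡⟨ toℕ-left-> (leftⁱ s x) (subst (0 <_) (sym IH) (m<n⇒0<n∸m s<x)) ⟩
      toℕ (leftⁱ s x) ∸ 1    ≡⟨ cong (_∸ 1) IH ⟩
      toℕ x ∸ s ∸ 1          ≡⟨ ∸-+-assoc (toℕ x) s 1 ⟩
      toℕ x ∸ (s + 1)        ≡⟨ cong (toℕ x ∸_) (+-comm s 1) ⟩
      toℕ x ∸ suc s          ∎
      where
      open ≡-Reasoning
      IH : toℕ (leftⁱ s x) ≡ toℕ x ∸ s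
      IH = toℕ-leftⁱ s x (<⇒≤ s<x)

    leftⁱ-suc : ∀ s x → leftⁱ (suc s) x ≡ leftⁱ s (left x)
    leftⁱ-suc zero    x = refl
    leftⁱ-suc (suc s) x = cong left (leftⁱ-suc s x)

    toℕ-leftⁱ-zero : ∀ s → s ≤ m → toℕ (leftⁱ (suc s) fzero) ≡ n ∸ suc s
    toℕ-leftⁱ-zero s s≤m = begin
      toℕ (leftⁱ (suc s) fzero)   ≡⟨ cong toℕ (leftⁱ-suc s fzero) ⟩
      toℕ (leftⁱ s (left fzero))  ≡⟨ toℕ-leftⁱ s (left fzero) (subst (s ≤_) (sym left0≡m) s≤m) ⟩
      toℕ (left fzero) ∸ s        ≡⟨ cong (_∸ s) left0≡m ⟩
      m ∸ s                       ∎
      where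
      open ≡-Reasoning
      left0≡m : toℕ (left fzero) ≡ m
      left0≡m = trans (toℕ-left fzero) (m<n⇒m%n≡m (n<1+n m))

    -- The robber's side of the cycle, [0 , p) or [p , n), is fixed by his start; the two cops then
    -- walk towards each other across that side, one step per round.
    sweepConfig : Bool → ℕ → Cops
    sweepConfig true  s = rightⁱ s fzero ∷ leftⁱ s pivot ∷ []
    sweepConfig false s = leftⁱ s fzero ∷ rightⁱ s pivot ∷ []

    start : Fin n → List (Fin n) → Fin n
    start r []      = r
    start r (r′ ∷ h) = start r′ h

    sweepPos : List (Fin n) → Cops
    sweepPos []      = fzero ∷ pivot ∷ []
    sweepPos (r ∷ h) = sweepConfig (toℕ (start r h) <ᵇ p) (suc (length h))

    sweepConfig-step : ∀ b s i → CopStep (lookup (sweepConfig b s) i) (lookup (sweepConfig b (suc s)) i)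
    sweepConfig-step true  s fzero        = inj₂ (inj₁ refl)
    sweepConfig-step true  s (fsuc fzero) = inj₂ (inj₂ refl)
    sweepConfig-step false s fzero        = inj₂ (inj₂ refl)
    sweepConfig-step false s (fsuc fzero) = inj₂ (inj₁ refl)

    sweepPos-valid : ∀ h r i → CopStep (lookup (sweepPos h) i) (lookup (sweepPos (r ∷ h)) i)
    sweepPos-valid []       r i with toℕ r <ᵇ p
    ... | true  = sweepConfig-step true 0 i
    ... | false = sweepConfig-step false 0 i
    sweepPos-valid (r′ ∷ h) r i = sweepConfig-step (toℕ (start r′ h) <ᵇ p) (suc (length h)) i

    sweep : Strategy
    sweep = record { pos = sweepPos ; valid = sweepPos-valid }

    sweepPos-walk : ∀ y ω → sweepPos (walk y ω) ≡ sweepConfig (toℕ y <ᵇ p) (suc (length ω))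
    sweepPos-walk y ω = cong₂ (λ z k → sweepConfig (toℕ z <ᵇ p) (suc k)) (start-walk ω) (length-history y ω)
      where
      start-walk : ∀ ω → start (position y ω) (history y ω) ≡ y
      start-walk []      = refl
      start-walk (b ∷ ω) = start-walk ω

    sweepConfig-walk : ∀ {b} y → (toℕ y <ᵇ p) ≡ b → ∀ ω → sweepPos (walk y ω) ≡ sweepConfig b (suc (length ω))
    sweepConfig-walk y side ω = trans (sweepPos-walk y ω) (cong (λ b → sweepConfig b (suc (length ω))) side)

    toℕ-pivot : toℕ pivot ≡ p
    toℕ-pivot = toℕ-fromℕ< p<n

    window-below : ∀ y → (toℕ y <ᵇ p) ≡ true → ∀ ω → alive sweep (walk y ω) ≡ true →
                   T (window 0 p ω (toℕ (position y ω)))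
    window-below y side = SweptArc.in-window sweep y 0 p (<⇒≤ p<n) fzero (fsuc fzero) z≤n y<p refl up down
      where
      y<p : toℕ y < p
      y<p = <ᵇ⇒< (toℕ y) p (subst T (sym side) tt)
      up : ∀ ω → suc (length ω) + suc (length ω) ≤ p →
           toℕ (lookup (sweepPos (walk y ω)) fzero) ≡ suc (length ω)
      up ω fits = trans (cong (λ c → toℕ (lookup c fzero)) (sweepConfig-walk y side ω))
                        (toℕ-rightⁱ (suc (length ω)) fzero (≤-<-trans (≤-trans (m≤m+n _ _) fits) p<n))
      down : ∀ ω → suc (length ω) + suc (length ω) ≤ p →
             toℕ (lookup (sweepPos (walk y ω)) (fsuc fzero)) ≡ p ∸ suc (length ω)
      down ω fits = trans (cong (λ c → toℕ (lookup c (fsuc fzero))) (sweepConfig-walk y side ω))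
        (trans (toℕ-leftⁱ (suc (length ω)) pivot (subst (_ ≤_) (sym toℕ-pivot) (≤-trans (m≤m+n _ _) fits)))
               (cong (_∸ suc (length ω)) toℕ-pivot))

    window-above : ∀ y → (toℕ y <ᵇ p) ≡ false → ∀ ω → alive sweep (walk y ω) ≡ true →
                   T (window p n ω (toℕ (position y ω)))
    window-above y side = SweptArc.in-window sweep y p n ≤-refl (fsuc fzero) fzero p≤y (toℕ<n y) toℕ-pivot up down
      where
      p≤y : p ≤ toℕ y
      p≤y = ≮⇒≥ λ y<p → subst T side (<⇒<ᵇ y<p)
      up : ∀ ω → p + suc (length ω) + suc (length ω) ≤ n →
           toℕ (lookup (sweepPos (walk y ω)) (fsuc fzero)) ≡ p + suc (length ω)
      up ω fits = trans (cong (λ c → toℕ (lookup c (fsuc fzero))) (sweepConfig-walk y side ω))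
        (trans (toℕ-rightⁱ (suc (length ω)) pivot (subst (λ k → k + suc (length ω) < n) (sym toℕ-pivot) p+s<n))
               (cong (_+ suc (length ω)) toℕ-pivot))
        where
        p+s<n : p + suc (length ω) < n
        p+s<n = <-≤-trans (m<m+n (p + suc (length ω)) (s≤s z≤n)) fits
      down : ∀ ω → p + suc (length ω) + suc (length ω) ≤ n →
             toℕ (lookup (sweepPos (walk y ω)) fzero) ≡ n ∸ suc (length ω)
      down ω fits = trans (cong (λ c → toℕ (lookup c fzero)) (sweepConfig-walk y side ω))
        (toℕ-leftⁱ-zero (length ω) (≤-pred (≤-trans (m≤n+m (suc (length ω)) (p + suc (length ω))) fits)))

    sweep-in-window : ∀ ω y → indicator (alive sweep (walk y ω)) ≤
                      indicator (window 0 p ω (toℕ (position y ω))) + indicator (window p n ω (toℕ (position y ω)))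
    sweep-in-window ω y with alive sweep (walk y ω) in al
    ... | false = z≤n
    ... | true with toℕ y <ᵇ p in side
    ...   | true  rewrite Equivalence.to T-≡ (window-below y side ω al) = s≤s z≤n
    ...   | false rewrite Equivalence.to T-≡ (window-above y side ω al) = m≤n+m 1 _

    sweepBound : ℕ → ℕ
    sweepBound t = (initialBonus t + initialBonus t) + ((p ∸ 2 ∸ (t + t)) + (n ∸ p ∸ 2 ∸ (t + t)))

    survivors-≤ : ∀ t → length (survivors sweep t) ≤ 2 ^ t * sweepBound t
    survivors-≤ t = ≤-trans (≤-reflexive (length-survivors sweep t)) (sumBy-bitStrings-≤ t _ sweepBound per-walk)
      where
      per-walk : ∀ ω → sumBy (λ y → indicator (alive sweep (walk y ω))) (allFin n) ≤ sweepBound (length ω)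
      per-walk ω = begin
        sumBy (λ y → indicator (alive sweep (walk y ω))) (allFin n) ≤⟨ sumBy-mono (sweep-in-window ω) (allFin n) ⟩
        sumBy (λ y → G (toℕ (position y ω))) (allFin n)             ≡⟨ sumBy-position ω (G ∘ toℕ) ⟩
        sumBy (G ∘ toℕ) (allFin n)                                 ≡⟨ sumBy-allFin n G ⟩
        Σ< n G                                                     ≡⟨ Σ<-+ n _ _ ⟩
        Σ< n (indicator ∘ window 0 p ω) + Σ< n (indicator ∘ window p n ω)
          ≤⟨ +-mono-≤ (count-window 0 p ω n) (count-window p n ω n) ⟩
        (i + (p ∸ 2 ∸ (l + l))) + (i + (n ∸ p ∸ 2 ∸ (l + l)))     ≡⟨ regroup i _ _ ⟩
        sweepBound l                                               ∎
        where
        open ≤-Reasoning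
        l : ℕ
        l = length ω
        i : ℕ
        i = initialBonus l
        G : ℕ → ℕ
        G ρ = indicator (window 0 p ω ρ) + indicator (window p n ω ρ)
        regroup : ∀ i a b → (i + a) + (i + b) ≡ (i + i) + (a + b)
        regroup = solve-∀

    Σ<-sweepBound : ∀ N → Σ< N sweepBound ≤ 2 + staircase (p ∸ 2) N + staircase (n ∸ p ∸ 2) N
    Σ<-sweepBound N = begin
      Σ< N sweepBound                                             ≡⟨ Σ<-+ N _ _ ⟩
      Σ< N (λ t → initialBonus t + initialBonus t) + Σ< N (λ t → (p ∸ 2 ∸ (t + t)) + (n ∸ p ∸ 2 ∸ (t + t)))
        ≡⟨ cong₂ _+_ (Σ<-+ N initialBonus initialBonus) (Σ<-+ N _ _) ⟩
      (Σ< N initialBonus + Σ< N initialBonus) + (staircase (p ∸ 2) N + staircase (n ∸ p ∸ 2) N)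
        ≤⟨ +-monoˡ-≤ _ (+-mono-≤ (Σ<-initialBonus N) (Σ<-initialBonus N)) ⟩
      2 + (staircase (p ∸ 2) N + staircase (n ∸ p ∸ 2) N)        ≡⟨ +-assoc 2 (staircase _ N) (staircase _ N) ⟨
      2 + staircase (p ∸ 2) N + staircase (n ∸ p ∸ 2) N          ∎
      where open ≤-Reasoning

module Bounds (m : ℕ) where

  open CycleArithmetic m using (n)
  open Cycle n
  open TailSums m using (partialE-≥; partialE-≤)

  dct-≥ : 4 ≤ n → (σ : Strategy) → ∀ ε → 0ℚ ℚ.< ε →
    ∃ λ N → (((ℤ.+ n) ℚ./ 8) ℚ.- ((ℤ.+ (6 * ⌊log₂ n ⌋)) ℚ./ 8)) ℚ.- ε ℚ.≤ partialE σ N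
  dct-≥ 4≤n σ ε ε>0 =
    n , lower-bound-ℚ m (Σ< n survivalCount) ⌊log₂ n ⌋ ε (partialE σ n) square≤survivalSum 2≤log₂n ε>0
          (partialE-≥ σ survivalCount survivors-≥ n)
    where
    open LowerBound.Arcs m σ
    2≤log₂n : 2 ≤ ⌊log₂ n ⌋
    2≤log₂n = ≤-trans (≤-reflexive (sym (⌊log₂[2^n]⌋≡n 2))) (⌊log₂⌋-mono-≤ 4≤n)

  dct-≤ : 4 ≤ n → ∀ ε → 0ℚ ℚ.< ε →
    Σ Strategy λ σ → ∀ N → partialE σ N ℚ.≤ ((ℤ.+ (n + 1)) ℚ./ 8) ℚ.+ ε
  dct-≤ 4≤n ε ε>0 =
    sweep , λ N → ≤-+-positive (upper-bound-ℚ m (Σ< N sweepBound) (partialE sweep N) (8Σ≤n[n+1] N)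
                                 (partialE-≤ sweep sweepBound survivors-≤ N)) ε>0
    where
    p : ℕ
    p = ⌊ n /2⌋
    q : ℕ
    q = ⌈ n /2⌉
    open UpperBound.Sweep m p (⌊n/2⌋<n m)
    2≤p : 2 ≤ p
    2≤p = ⌊n/2⌋-mono 4≤n
    n∸p≡q : n ∸ p ≡ q
    n∸p≡q = trans (cong (_∸ p) (sym (⌊n/2⌋+⌈n/2⌉≡n n))) (m+n∸m≡n p q)
    8Σ≤n[n+1] : ∀ N → 8 * Σ< N sweepBound ≤ n * (n + 1)
    8Σ≤n[n+1] N = ≤-trans (*-monoʳ-≤ 8 (Σ<-sweepBound N))
      (≤-trans (subst (λ r → 8 * (2 + staircase (p ∸ 2) N + staircase (r ∸ 2) N) ≤ 2 * (p * p) + 2 * (q * q))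
                      (sym n∸p≡q) (staircase-pair-upper p q N 2≤p (≤-trans 2≤p (⌊n/2⌋≤⌈n/2⌉ n))))
               (halves-squares n))

theorem3p3 :
    Σ ℕ λ C → (n : ℕ) .{{_ : NonZero n}} → 4 ≤ n →
      ((σ : Cycle.Strategy n) → (ε : ℚ) → 0ℚ ℚ.< ε →
        ∃ λ N → (((ℤ.+ n) ℚ./ 8) ℚ.- ((ℤ.+ (C * ⌊log₂ n ⌋)) ℚ./ 8)) ℚ.- ε ℚ.≤ Cycle.partialE n σ N)
      ×
      ((ε : ℚ) → 0ℚ ℚ.< ε →
        Σ (Cycle.Strategy n) λ σ → (N : ℕ) → Cycle.partialE n σ N ℚ.≤ ((ℤ.+ (n + 1)) ℚ./ 8) ℚ.+ ε)
theorem3p3 = 6 , λ where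
  (suc m) 4≤n → Bounds.dct-≥ m 4≤n , Bounds.dct-≤ m 4≤n
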